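{- There is a polynomial-time algorithm for Robust Interval Scheduling.
   Context: Robust Interval Scheduling: the input is a finite set $I=\{i_1,\dots,i_n\}$ of jobs, job $i_j$ being a half-open interval $[a_j,b_j)$ with $a_j,b_j\in\mathbb{N}$, $a_j\le b_j$, together with weights $w:I\to\mathbb{R}_{\ge0}$. Let $\mathcal{F}$ be the family of subsets of $I$ consisting of pairwise disjoint intervals. The task is to solve $$\max_{S\in\mathcal{F}}\ \min_{f\in I\cup\{\emptyset\}}\ \max_{\substack{e\in (I\setminus(S\cup\{f\}))\cup\{\emptyset\}\\ (S\setminus\{f\})\cup\{e\}\in\mathcal{F}}} w\big((S\setminus\{f\})\cup\{e\}\big),$$ where $w$ of a set is the sum of weights, $f=\emptyset$ means no job is deleted and $e=\emptyset$ means no job is added (i.e., output an optimal first-stage solution $S$). -}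

module Defs where

open import Level using (_⊔_; 0ℓ) renaming (suc to lsuc)
open import Algebra.Bundles using (AbelianGroup)
open import Algebra.Core using (Op₁; Op₂)
open import Algebra.Structures using (IsAbelianGroup)
import Algebra.Definitions.RawMonoid as RawMonoidOps
open import Data.Bool.Base using (Bool; true; false; if_then_else_)
open import Data.Fin.Base using (Fin; toℕ; fromℕ<)
import Data.Fin.Properties as Fin
open import Data.Fin.Subset as Subset using (Subset; _∈_; _∉_; _∪_; ⁅_⁆)
open import Data.Fin.Subset.Properties using (_∈?_)
open import Data.List.Base using (List; []; _∷_; map; filter; allFin)
import Data.List.Extrema as Extrema
open import Data.Maybe.Base using (Maybe; just; nothing)
open import Data.Nat.Base as ℕ using (ℕ; suc)
open import Data.Nat.Logarithm using (⌊log₂_⌋)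
import Data.Nat.Properties as ℕ
import Data.Rational.Base as ℚ
import Data.Rational.Properties as ℚ
open import Data.Product.Base using (∃-syntax; _×_; _,_)
open import Data.Vec.Base using (lookup; tabulate)
open import Function.Base using (_∘_)
open import Relation.Binary.Bundles using (DecTotalOrder)
open import Relation.Binary.Core using (Rel)
open import Relation.Binary.PropositionalEquality.Core using (_≡_; _≢_)
open import Relation.Binary.Structures using (IsDecTotalOrder)
open import Relation.Nullary.Decidable.Core using (Dec; yes; no; does; _×-dec_; _→-dec_; ¬?)
import Relation.Unary as Unary
open Unary using (Pred)

-- Stand-in for (ℝ, +, ≤), which the library lacks: the classical reals are
-- an instance, and so is ℚ (see ℚ-orderedAbelianGroup below).

record OrderedAbelianGroup c ℓ₁ ℓ₂ : Set (lsuc (c ⊔ ℓ₁ ⊔ ℓ₂)) where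
  infix  8 -_
  infixl 6 _+_
  infix  4 _≈_ _≤_
  field
    Carrier         : Set c
    _≈_             : Rel Carrier ℓ₁
    _≤_             : Rel Carrier ℓ₂
    _+_             : Op₂ Carrier
    0#              : Carrier
    -_              : Op₁ Carrier
    isAbelianGroup  : IsAbelianGroup _≈_ _+_ 0# -_
    isDecTotalOrder : IsDecTotalOrder _≈_ _≤_
    +-monoʳ-≤       : ∀ x {y z} → y ≤ z → (x + y) ≤ (x + z)

  abelianGroup : AbelianGroup c ℓ₁
  abelianGroup = record { isAbelianGroup = isAbelianGroup }

  decTotalOrder : DecTotalOrder c ℓ₁ ℓ₂
  decTotalOrder = record { isDecTotalOrder = isDecTotalOrder }

  open IsDecTotalOrder isDecTotalOrder public using (_≤?_)
  open DecTotalOrder decTotalOrder public using (totalOrder)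
  open RawMonoidOps (AbelianGroup.rawMonoid abelianGroup) public using (sum)

ℚ-orderedAbelianGroup : OrderedAbelianGroup 0ℓ 0ℓ 0ℓ
ℚ-orderedAbelianGroup = record
  { isAbelianGroup  = ℚ.+-0-isAbelianGroup
  ; isDecTotalOrder = ℚ.≤-isDecTotalOrder
  ; +-monoʳ-≤       = ℚ.+-monoʳ-≤
  }

-- The model of computation is a random access machine with real-valued
-- data, presented as a structured imperative language.  Memory consists of
-- arrays of naturals and arrays of weights; an array is named by a numeral
-- occurring in the program and indexed by a computed natural.  Only
-- additive arithmetic is available, on both kinds of data.  With
-- multiplication at unit cost, numbers of exponential bit length would be
-- computable in polynomially many steps; with additive operations the bit
-- length of memory contents (for rationals, of numerators over a common
-- denominator of the input) grows by O(1) per step, so that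
-- polynomially many unit-cost steps on integral or rational data are
-- polynomial time on a Turing machine.

infixl 6 _⊞_ _⊟_
infixr 5 _⨾_
infix  4 _≤ᴺ_ _≤ᵂ_

data NatExpr : Set where
  lit : ℕ → NatExpr
  get : (array : ℕ) (index : NatExpr) → NatExpr
  _⊞_ : NatExpr → NatExpr → NatExpr
  _⊟_ : NatExpr → NatExpr → NatExpr

data WeightExpr : Set where
  null : WeightExpr
  get  : (array : ℕ) (index : NatExpr) → WeightExpr
  _⊞_  : WeightExpr → WeightExpr → WeightExpr
  _⊟_  : WeightExpr → WeightExpr → WeightExpr

data Test : Set where
  _≤ᴺ_ : NatExpr → NatExpr → Test
  _≤ᵂ_ : WeightExpr → WeightExpr → Test

data Program : Set where
  skip   : Program
  setᴺ   : (array : ℕ) (index : NatExpr) → NatExpr → Program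
  setᵂ   : (array : ℕ) (index : NatExpr) → WeightExpr → Program
  _⨾_    : Program → Program → Program
  if     : Test → Program → Program → Program
  while  : Test → Program → Program

costᴺ : NatExpr → ℕ
costᴺ (lit _)   = 1
costᴺ (get _ e) = suc (costᴺ e)
costᴺ (e ⊞ e′)  = suc (costᴺ e ℕ.+ costᴺ e′)
costᴺ (e ⊟ e′)  = suc (costᴺ e ℕ.+ costᴺ e′)

costᵂ : WeightExpr → ℕ
costᵂ null      = 1
costᵂ (get _ e) = suc (costᴺ e)
costᵂ (e ⊞ e′)  = suc (costᵂ e ℕ.+ costᵂ e′)
costᵂ (e ⊟ e′)  = suc (costᵂ e ℕ.+ costᵂ e′)

costᵀ : Test → ℕ
costᵀ (e ≤ᴺ e′) = suc (costᴺ e ℕ.+ costᴺ e′)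
costᵀ (e ≤ᵂ e′) = suc (costᵂ e ℕ.+ costᵂ e′)

write : ∀ {a} {A : Set a} → (ℕ → ℕ → A) → ℕ → ℕ → A → (ℕ → ℕ → A)
write M k i x k′ i′ = if does ((k ℕ.≟ k′) ×-dec (i ℕ.≟ i′)) then x else M k′ i′

module Semantics {c ℓ₁ ℓ₂} (R : OrderedAbelianGroup c ℓ₁ ℓ₂) where

  open OrderedAbelianGroup R

  record State : Set c where
    constructor ⟨_,_⟩
    field
      nats    : ℕ → ℕ → ℕ
      weights : ℕ → ℕ → Carrier

  open State public

  evalᴺ : NatExpr → State → ℕ
  evalᴺ (lit m)   s = m
  evalᴺ (get k e) s = nats s k (evalᴺ e s)
  evalᴺ (e ⊞ e′)  s = evalᴺ e s ℕ.+ evalᴺ e′ s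
  evalᴺ (e ⊟ e′)  s = evalᴺ e s ℕ.∸ evalᴺ e′ s

  evalᵂ : WeightExpr → State → Carrier
  evalᵂ null      s = 0#
  evalᵂ (get k e) s = weights s k (evalᴺ e s)
  evalᵂ (e ⊞ e′)  s = evalᵂ e s + evalᵂ e′ s
  evalᵂ (e ⊟ e′)  s = evalᵂ e s + (- evalᵂ e′ s)

  evalᵀ : Test → State → Bool
  evalᵀ (e ≤ᴺ e′) s = does (evalᴺ e s ℕ.≤? evalᴺ e′ s)
  evalᵀ (e ≤ᵂ e′) s = does (evalᵂ e s ≤? evalᵂ e′ s)

  -- p ⊢ s ⇓ s′ # t : started in s, the program p halts in s′ after time t.

  infix 4 _⊢_⇓_#_

  data _⊢_⇓_#_ : Program → State → State → ℕ → Set c where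
    skip    : ∀ {s} → skip ⊢ s ⇓ s # 1
    setᴺ    : ∀ {k i e s} →
              setᴺ k i e ⊢ s ⇓ ⟨ write (nats s) k (evalᴺ i s) (evalᴺ e s) , weights s ⟩
                         # suc (costᴺ i ℕ.+ costᴺ e)
    setᵂ    : ∀ {k i e s} →
              setᵂ k i e ⊢ s ⇓ ⟨ nats s , write (weights s) k (evalᴺ i s) (evalᵂ e s) ⟩
                         # suc (costᴺ i ℕ.+ costᵂ e)
    _⨾_     : ∀ {p q s s′ s″ t t′} →
              p ⊢ s ⇓ s′ # t → q ⊢ s′ ⇓ s″ # t′ → p ⨾ q ⊢ s ⇓ s″ # t ℕ.+ t′
    if-yes  : ∀ {b p q s s′ t} → evalᵀ b s ≡ true →
              p ⊢ s ⇓ s′ # t → if b p q ⊢ s ⇓ s′ # costᵀ b ℕ.+ t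
    if-no   : ∀ {b p q s s′ t} → evalᵀ b s ≡ false →
              q ⊢ s ⇓ s′ # t → if b p q ⊢ s ⇓ s′ # costᵀ b ℕ.+ t
    stop    : ∀ {b p s} → evalᵀ b s ≡ false →
              while b p ⊢ s ⇓ s # costᵀ b
    iterate : ∀ {b p s s′ s″ t t′} → evalᵀ b s ≡ true →
              p ⊢ s ⇓ s′ # t → while b p ⊢ s′ ⇓ s″ # t′ →
              while b p ⊢ s ⇓ s″ # costᵀ b ℕ.+ t ℕ.+ t′

-- Coefficients, constant term first.

Polynomial : Set
Polynomial = List ℕ

evalPoly : Polynomial → ℕ → ℕ
evalPoly []       x = 0
evalPoly (a ∷ as) x = a ℕ.+ x ℕ.* evalPoly as x

module _ {c ℓ₁ ℓ₂} (R : OrderedAbelianGroup c ℓ₁ ℓ₂) where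

  open Semantics R

  record Problem i o ℓ : Set (c ⊔ lsuc (i ⊔ o ⊔ ℓ)) where
    field
      Instance   : Set i
      Output     : Instance → Set o
      IsSolution : (x : Instance) → Output x → Set ℓ
      size       : Instance → ℕ
      encode     : Instance → State
      decode     : (x : Instance) → State → Output x

  PolynomialTimeAlgorithm : ∀ {i o ℓ} → Problem i o ℓ → Set (c ⊔ i ⊔ ℓ)
  PolynomialTimeAlgorithm P =
    ∃[ p ] ∃[ q ] ∀ (x : Instance) → ∃[ s ] ∃[ t ]
      (p ⊢ encode x ⇓ s # t) × (t ℕ.≤ evalPoly q (size x)) × IsSolution x (decode x s)
    where open Problem P

module RIS {c ℓ₁ ℓ₂} (R : OrderedAbelianGroup c ℓ₁ ℓ₂) where

  open OrderedAbelianGroup R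
  open Extrema totalOrder using (max; min)
  open Semantics R

  record Job : Set (c ⊔ ℓ₂) where
    field
      start       : ℕ
      end         : ℕ
      start≤end   : start ℕ.≤ end
      weight      : Carrier
      nonNegative : 0# ≤ weight

  open Job public

  record Jobs : Set (c ⊔ ℓ₂) where
    field
      count : ℕ
      job   : Fin count → Job

  open Jobs public

  -- [ start , end ), a set of natural numbers; since the endpoints are
  -- natural, two such sets are disjoint iff the real intervals are.

  interval : Job → Pred ℕ 0ℓ
  interval j x = start j ℕ.≤ x × x ℕ.< end j

  Disjoint : Job → Job → Set
  Disjoint j k = interval j Unary.⊥ interval k

  disjoint? : ∀ j k → Dec (Disjoint j k)
  disjoint? j k with (m ℕ.<? end j) ×-dec (m ℕ.<? end k)
    where m = start j ℕ.⊔ start k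
  ... | yes (m<j , m<k) = no λ d → d
          ( (ℕ.m≤m⊔n (start j) (start k) , m<j)
          , (ℕ.m≤n⊔m (start j) (start k) , m<k))
  ... | no ¬m = yes λ ((j≤x , x<j) , (k≤x , x<k)) → ¬m
          ( ℕ.≤-<-trans (ℕ.⊔-lub j≤x k≤x) x<j
          , ℕ.≤-<-trans (ℕ.⊔-lub j≤x k≤x) x<k)

  module _ (I : Jobs) where

    private
      n = count I

    Feasible : Subset n → Set
    Feasible S = ∀ i j → i ∈ S → j ∈ S → i ≢ j → Disjoint (job I i) (job I j)

    feasible? : ∀ S → Dec (Feasible S)
    feasible? S = Fin.all? λ i → Fin.all? λ j →
      (i ∈? S) →-dec ((j ∈? S) →-dec (¬? (i Fin.≟ j) →-dec disjoint? (job I i) (job I j)))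

    w : Subset n → Carrier
    w S = sum λ i → if lookup S i then weight (job I i) else 0#

    -- An element of I ∪ {∅} is a Maybe (Fin n), with nothing for ∅.

    infixl 6 _∖_ _∪∙_

    _∖_ : Subset n → Maybe (Fin n) → Subset n
    S ∖ nothing = S
    S ∖ just f  = S Subset.- f

    _∪∙_ : Subset n → Maybe (Fin n) → Subset n
    S ∪∙ nothing = S
    S ∪∙ just e  = S ∪ ⁅ e ⁆

    Addable : Subset n → Maybe (Fin n) → Fin n → Set
    Addable S f e = e ∉ S ∪∙ f × Feasible (S ∖ f ∪∙ just e)

    addable? : ∀ S f e → Dec (Addable S f e)
    addable? S f e = ¬? (e ∈? S ∪∙ f) ×-dec feasible? (S ∖ f ∪∙ just e)

    -- The first argument of max is the choice e = ∅, which is always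
    -- admissible when S is feasible.

    recovered : Subset n → Maybe (Fin n) → Carrier
    recovered S f = max (w (S ∖ f ∪∙ nothing))
                        (map (λ e → w (S ∖ f ∪∙ just e)) (filter (addable? S f) (allFin n)))

    -- The first argument of min is the choice f = ∅.

    robustValue : Subset n → Carrier
    robustValue S = min (recovered S nothing) (map (recovered S ∘ just) (allFin n))

    Optimal : Subset n → Set ℓ₂
    Optimal S = Feasible S × (∀ S′ → Feasible S′ → robustValue S′ ≤ robustValue S)

  bitLength : ℕ → ℕ
  bitLength m = suc ⌊log₂ m ⌋

  -- Endpoints are measured in binary; a weight counts as one unit.

  inputSize : Jobs → ℕ
  inputSize I = sumℕ λ i → bitLength (start (job I i)) ℕ.+ bitLength (end (job I i)) ℕ.+ 1
    where open RawMonoidOps ℕ.+-0-rawMonoid renaming (sum to sumℕ)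

  fill : ∀ {a} {A : Set a} {n} → A → (Fin n → A) → ℕ → A
  fill {n = n} z v i with i ℕ.<? n
  ... | yes i<n = v (fromℕ< i<n)
  ... | no  _   = z

  -- Arrays of naturals: 0 holds the number of jobs (in cell 0), 1 the left
  -- endpoints, 2 the right endpoints.  Array 0 of weights holds the weights.
  -- Everything else is zero.

  load : Jobs → State
  load I = ⟨ natInput , weightInput ⟩
    where
    natInput : ℕ → ℕ → ℕ
    natInput 0 0 = count I
    natInput 1 i = fill 0 (start ∘ job I) i
    natInput 2 i = fill 0 (end ∘ job I) i
    natInput _ _ = 0

    weightInput : ℕ → ℕ → Carrier
    weightInput 0 i = fill 0# (weight ∘ job I) i
    weightInput _ _ = 0#

  -- The answer is left in array 3 of naturals, as a characteristic vector
  -- with any non-zero entry meaning membership.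

  result : (I : Jobs) → State → Subset (count I)
  result I s = tabulate λ i → 0 ℕ.<ᵇ nats s 3 (toℕ i)

RobustIntervalScheduling : ∀ {c ℓ₁ ℓ₂} (R : OrderedAbelianGroup c ℓ₁ ℓ₂) →
                           Problem R (c ⊔ ℓ₂) 0ℓ ℓ₂
RobustIntervalScheduling R = record
  { Instance   = Jobs
  ; Output     = λ I → Subset (count I)
  ; IsSolution = Optimal
  ; size       = inputSize
  ; encode     = load
  ; decode     = result
  }
  where open RIS R

{-# OPTIONS --safe #-}

-- Since the optimal recovery exchanges at most one job, the robust value of S is
-- w S + δ with δ = w x − w y for some jobs x, y (or ∅).  The algorithm guesses x
-- and y together with the heaviest and the second heaviest job e₁, e₂ that can
-- be added to S.  For a fixed guess, "the robust value is at least w S + δ" is a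
-- local condition on S: e₁ and e₂ have weight at least δ, and every p ∈ S with
-- neighbours o and q in S has a replacement of weight at least w p + δ that is
-- e₁ or fits between o and q.  A heaviest chain satisfying it is found by dynamic
-- programming over pairs of consecutive jobs, in the form of n + 1 rounds of
-- Bellman–Ford relaxation.

module Submission where

open import Defs
open import Algebra.Bundles using (AbelianGroup; CommutativeMonoid)
import Algebra.Definitions.RawMonoid as RawMonoidOps
import Algebra.Properties.CommutativeSemigroup as CommutativeSemigroupProperties
import Data.Bool.Base as Bool
open import Data.Bool.Base using (Bool; _∧_; _∨_; false; if_then_else_; true)
open import Data.Bool.Properties using (∧-conicalʳ; ∧-conicalˡ; ∨-conicalʳ; ∨-conicalˡ)
open import Data.Empty using (⊥-elim)
open import Data.Fin.Base using (Fin; fromℕ<; suc; toℕ; zero)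
import Data.Fin.Properties as Fin
open import Data.Fin.Subset using (Nonempty; Subset; _-_; _∈_; _∉_; _∪_; _⊆_; inside; outside; ⁅_⁆; ∣_∣; ⊥)
open import Data.Fin.Subset.Properties
open import Data.List.Base using (List; []; _∷_; allFin; filter; map)
import Data.List.Extrema as Extrema
open import Data.List.Membership.Propositional.Properties using (∈-allFin; ∈-filter⁺; ∈-filter⁻; ∈-map⁺; ∈-map⁻)
import Data.List.Relation.Unary.All as All
import Data.List.Relation.Unary.All.Properties as All
open import Data.Maybe.Base using (Maybe; just; nothing)
open import Data.Maybe.Properties using (just-injective; ≡-dec)
open import Data.Nat.Base as ℕ using (ℕ; zero; suc; z≤n; s≤s)
open import Data.Nat.DivMod using ([m+kn]%n≡m%n; _%_; m<n⇒m%n≡m)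
import Data.Nat.Properties as ℕ
open import Data.Product.Base using (_,_; _×_; proj₁; proj₂; ∃-syntax)
open import Data.Sum.Base using ([_,_]′; _⊎_; inj₁; inj₂; swap)
open import Data.Unit.Polymorphic.Base using (tt; ⊤)
open import Data.Vec.Base using ([]; _∷_; here; lookup; there)
open import Data.Vec.Properties using (tabulate-cong; tabulate∘lookup)
open import Function.Base using (_∘_; id)
open import Level using (Lift; _⊔_; lift; lower)
open import Relation.Binary.Bundles using (DecTotalOrder)
open import Relation.Binary.Definitions using (tri<; tri>; tri≈)
import Relation.Binary.PropositionalEquality as ≡
open import Relation.Binary.PropositionalEquality using (_≡_; _≢_; cong; cong₂; refl; subst; subst₂; sym; trans)
import Relation.Binary.Reasoning.PartialOrder as PosetReasoning
import Relation.Binary.Reasoning.Setoid as SetoidReasoning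
open import Relation.Nullary.Decidable using (Dec; _×-dec_; _⊎-dec_; dec-false; dec-true; decidable-stable; does; map′; no; yes; ¬?)
open import Relation.Nullary.Negation using (contradiction; ¬_)

-- A deletion outside `S` is best answered by `e₁`, or by `e₂` when `e₁` itself is deleted. For the
-- deletion of `p ∈ S`, the best replacement either lies between the neighbours of `p` in `S` or is
-- compatible with all of `S`; in the latter case `e₁` is at least as heavy. So a global worst case
-- becomes a condition on triples of consecutive members. Pairs are the right states because a step
-- from (o, p) to (p, q) does not depend on the rest of the prefix: a heavier prefix with the same
-- last pair can always be substituted.
--
-- Guesses need no further verification. Any guess that passes the local tests gives a lower bound w
-- S + δ on the robust value, and for every feasible `S` some guess makes this bound exact. Hence
-- the largest bound over all guesses belongs to an optimal set, and no robust value is ever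
-- computed.
--
-- The machine only adds and subtracts, and its cells hold numbers. A table entry therefore encodes
-- a whole set as one natural that is extended by an addition, and the products needed for array
-- positions are tabulated beforehand.

infixr 3 _and_
infixr 2 _or_

-- Structured code with bounded loops, its compilation and its time polynomial

data Cond : Set where
  test    : Test → Cond
  _and_   : Cond → Cond → Cond
  _or_    : Cond → Cond → Cond
  not     : Cond → Cond

-- loop v b runs b with v = 0, …, n, where n is the number of jobs and the
-- variable v is cell 0 of the array v of naturals.

data Code : Set where
  skip : Code
  setᴺ : (array : ℕ) (index : NatExpr) → NatExpr → Code
  setᵂ : (array : ℕ) (index : NatExpr) → WeightExpr → Code
  _⨾_  : Code → Code → Code
  if   : Cond → Code → Code → Code
  loop : ℕ → Code → Code

var : ℕ → NatExpr
var v = get v (lit 0)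

-- Short-circuit evaluation by nested atomic tests. Copying `p` and `q` lengthens the program, which
-- is fixed once and for all, but not its running time.
branch : Cond → Program → Program → Program
branch (test t)  p q = if t p q
branch (a and b) p q = branch a (branch b p q) q
branch (a or b)  p q = branch a p (branch b p q)
branch (not a)   p q = branch a q p

increment : ℕ → Program
increment v = setᴺ v (lit 0) (var v ⊞ lit 1)

compile : Code → Program
compile skip         = skip
compile (setᴺ k i e) = setᴺ k i e
compile (setᵂ k i e) = setᵂ k i e
compile (b ⨾ c)      = compile b ⨾ compile c
compile (if a b c)   = branch a (compile b) (compile c)
compile (loop v b)   =
  setᴺ v (lit 0) (lit 0) ⨾ while (var v ≤ᴺ var 0) (compile b ⨾ increment v)

writes : ℕ → Code → Bool
writes k skip          = false
writes k (setᴺ k′ _ _) = does (k′ ℕ.≟ k)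
writes k (setᵂ _ _ _)  = false
writes k (b ⨾ c)       = writes k b ∨ writes k c
writes k (if _ b c)    = writes k b ∨ writes k c
writes k (loop v b)    = does (v ℕ.≟ k) ∨ writes k b

-- A body that wrote to its own counter could spoil the count of n + 1 rounds. Since `writes` also
-- sees the counters of inner loops, nested loops are forced to use different variables.
loopsIntact : Code → Bool
loopsIntact skip         = true
loopsIntact (setᴺ _ _ _) = true
loopsIntact (setᵂ _ _ _) = true
loopsIntact (b ⨾ c)      = loopsIntact b ∧ loopsIntact c
loopsIntact (if _ b c)   = loopsIntact b ∧ loopsIntact c
loopsIntact (loop v b)   = Bool.not (writes v b) ∧ loopsIntact b

infixl 6 _⊕_

_⊕_ : Polynomial → Polynomial → Polynomial
[]       ⊕ q        = q
(a ∷ p)  ⊕ []       = a ∷ p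
(a ∷ p)  ⊕ (b ∷ q)  = a ℕ.+ b ∷ p ⊕ q

evalPoly-⊕ : ∀ p q x → evalPoly (p ⊕ q) x ≡ evalPoly p x ℕ.+ evalPoly q x
evalPoly-⊕ []      q       x = refl
evalPoly-⊕ (a ∷ p) []      x = sym (ℕ.+-identityʳ _)
evalPoly-⊕ (a ∷ p) (b ∷ q) x
  rewrite evalPoly-⊕ p q x
        | ℕ.*-distribˡ-+ x (evalPoly p x) (evalPoly q x) =
  +-interchange a b (x ℕ.* evalPoly p x) (x ℕ.* evalPoly q x)
  where
  open CommutativeSemigroupProperties ℕ.+-commutativeSemigroup
    using () renaming (interchange to +-interchange)

evalPoly-mono : ∀ p {x y} → x ℕ.≤ y → evalPoly p x ℕ.≤ evalPoly p y
evalPoly-mono []      x≤y = z≤n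
evalPoly-mono (a ∷ p) x≤y = ℕ.+-monoʳ-≤ a (ℕ.*-mono-≤ x≤y (evalPoly-mono p x≤y))

costᶜ : Cond → ℕ
costᶜ (test t)  = costᵀ t
costᶜ (a and b) = costᶜ a ℕ.+ costᶜ b
costᶜ (a or b)  = costᶜ a ℕ.+ costᶜ b
costᶜ (not a)   = costᶜ a

time : Code → Polynomial
time skip         = 1 ∷ []
time (setᴺ k i e) = suc (costᴺ i ℕ.+ costᴺ e) ∷ []
time (setᵂ k i e) = suc (costᴺ i ℕ.+ costᵂ e) ∷ []
time (b ⨾ c)      = time b ⊕ time c
time (if a b c)   = (costᶜ a ∷ []) ⊕ (time b ⊕ time c)
-- The constant 8 pays for the initial assignment (3) and the failing test (5), the constant 11 for
-- a successful test (5) and an increment (6). There are n + 1 rounds, whence `round ⊕ (0 ∷ round)`.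
time (loop v b)   = (8 ∷ []) ⊕ (round ⊕ (0 ∷ round))
  where round = (11 ∷ []) ⊕ time b

-- Total semantics of structured code, correctness of compilation, loop rules

module Execution {c ℓ₁ ℓ₂} (R : OrderedAbelianGroup c ℓ₁ ℓ₂) where

  open OrderedAbelianGroup R
  open Semantics R

  holds : Cond → State → Set ℓ₂
  holds (test (e ≤ᴺ e′)) s = Lift ℓ₂ (evalᴺ e s ℕ.≤ evalᴺ e′ s)
  holds (test (e ≤ᵂ e′)) s = evalᵂ e s ≤ evalᵂ e′ s
  holds (a and b)        s = holds a s × holds b s
  holds (a or b)         s = holds a s ⊎ holds b s
  holds (not a)          s = ¬ holds a s

  holds? : ∀ a s → Dec (holds a s)
  holds? (test (e ≤ᴺ e′)) s = map′ lift lower (evalᴺ e s ℕ.≤? evalᴺ e′ s)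
  holds? (test (e ≤ᵂ e′)) s = evalᵂ e s ≤? evalᵂ e′ s
  holds? (a and b)        s = holds? a s ×-dec holds? b s
  holds? (a or b)         s = holds? a s ⊎-dec holds? b s
  holds? (not a)          s = ¬? (holds? a s)

  assign : ℕ → ℕ → State → State
  assign v x s = ⟨ write (nats s) v 0 x , weights s ⟩

  iterateFrom : (State → State) → ℕ → ℕ → ℕ → State → State
  iterateFrom f v i zero    s = s
  iterateFrom f v i (suc k) s = iterateFrom f v (suc i) k (assign v (suc i) (f s))

  -- A total function, because a loop reads its number of rounds on entry. That the compiled `while`
  -- does the same needs the syntactic conditions of `compile-⇓`.
  exec : Code → State → State
  exec skip         s = s
  exec (setᴺ k i e) s = ⟨ write (nats s) k (evalᴺ i s) (evalᴺ e s) , weights s ⟩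
  exec (setᵂ k i e) s = ⟨ nats s , write (weights s) k (evalᴺ i s) (evalᵂ e s) ⟩
  exec (b ⨾ c)      s = exec c (exec b s)
  exec (if a b c)   s = if does (holds? a s) then exec b s else exec c s
  exec (loop v b)   s = iterateFrom (exec b) v 0 (suc (nats s 0 0)) (assign v 0 s)

  write-hit : ∀ {a} {A : Set a} (M : ℕ → ℕ → A) k i x → write M k i x k i ≡ x
  write-hit M k i x
    rewrite dec-true ((k ℕ.≟ k) ×-dec (i ℕ.≟ i)) (refl , refl) = refl

  write-miss : ∀ {a} {A : Set a} (M : ℕ → ℕ → A) k i x {k′ i′} →
               ¬ (k ≡ k′ × i ≡ i′) → write M k i x k′ i′ ≡ M k′ i′
  write-miss M k i x {k′} {i′} ≢
    rewrite dec-false ((k ℕ.≟ k′) ×-dec (i ℕ.≟ i′)) ≢ = refl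

  private
    ≟-false : ∀ {m n} → does (m ℕ.≟ n) ≡ false → m ≢ n
    ≟-false {m} {n} eq m≡n with () ← trans (sym (dec-true (m ℕ.≟ n) m≡n)) eq

  write-other : ∀ {a} {A : Set a} (M : ℕ → ℕ → A) k i x {k′} i′ →
                does (k ℕ.≟ k′) ≡ false → write M k i x k′ i′ ≡ M k′ i′
  write-other M k i x i′ eq = write-miss M k i x (≟-false {k} eq ∘ proj₁)

  frame : ∀ k b s i → writes k b ≡ false → nats (exec b s) k i ≡ nats s k i
  frame k skip          s i eq = refl
  frame k (setᴺ k′ j e) s i eq = write-other (nats s) k′ (evalᴺ j s) (evalᴺ e s) i eq
  frame k (setᵂ _ _ _)  s i eq = refl
  frame k (b ⨾ c)       s i eq = trans
    (frame k c (exec b s) i (∨-conicalʳ (writes k b) _ eq))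
    (frame k b s i (∨-conicalˡ (writes k b) _ eq))
  frame k (if a b c)    s i eq with does (holds? a s)
  ... | true  = frame k b s i (∨-conicalˡ (writes k b) _ eq)
  ... | false = frame k c s i (∨-conicalʳ (writes k b) _ eq)
  frame k (loop v b)    s i eq = trans (go 0 (suc (nats s 0 0)) (assign v 0 s))
    (write-other (nats s) v 0 0 i v≢k)
    where
    v≢k = ∨-conicalˡ (does (v ℕ.≟ k)) _ eq
    go : ∀ j m s → nats (iterateFrom (exec b) v j m s) k i ≡ nats s k i
    go j zero    s = refl
    go j (suc m) s = trans (go (suc j) m _) (trans
      (write-other (nats (exec b s)) v 0 (suc j) i v≢k)
      (frame k b s i (∨-conicalʳ (does (v ℕ.≟ k)) _ eq)))

  evalᵀ-holds : ∀ t s → evalᵀ t s ≡ does (holds? (test t) s)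
  evalᵀ-holds (e ≤ᴺ e′) s = refl
  evalᵀ-holds (e ≤ᵂ e′) s = refl

  Halts : Program → State → State → ℕ → Set c
  Halts p s s′ m = ∃[ t ] (p ⊢ s ⇓ s′ # t) × t ℕ.≤ m

  branch-⇓ : ∀ a {p q s s₁ s₂ m} →
             (does (holds? a s) ≡ true → Halts p s s₁ m) →
             (does (holds? a s) ≡ false → Halts q s s₂ m) →
             Halts (branch a p q) s (if does (holds? a s) then s₁ else s₂) (costᶜ a ℕ.+ m)
  branch-⇓ (test t) {s = s} onTrue onFalse
    with does (holds? (test t) s) in eq
  ... | true  = let u , r , u≤ = onTrue refl in
                _ , if-yes (trans (evalᵀ-holds t s) eq) r , ℕ.+-monoʳ-≤ _ u≤
  ... | false = let u , r , u≤ = onFalse refl in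
                _ , if-no (trans (evalᵀ-holds t s) eq) r , ℕ.+-monoʳ-≤ _ u≤
  branch-⇓ (a and b) {p} {q} {s} {s₁} {s₂} {m} onTrue onFalse
    with does (holds? a s) | branch-⇓ a {branch b p q} {q} {s} {if does (holds? b s) then s₁ else s₂} {s₂} {costᶜ b ℕ.+ m}
  ... | true  | r = subst (Halts _ _ _) (sym (ℕ.+-assoc (costᶜ a) _ _))
                      (r (λ _ → branch-⇓ b onTrue onFalse) λ ())
  ... | false | r = subst (Halts _ _ _) (sym (ℕ.+-assoc (costᶜ a) _ _))
                      (r (λ ()) λ _ → let u , h , u≤ = onFalse refl in u , h , ℕ.≤-trans u≤ (ℕ.m≤n+m m _))
  branch-⇓ (a or b) {p} {q} {s} {s₁} {s₂} {m} onTrue onFalse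
    with does (holds? a s) | branch-⇓ a {p} {branch b p q} {s} {s₁} {if does (holds? b s) then s₁ else s₂} {costᶜ b ℕ.+ m}
  ... | true  | r = subst (Halts _ _ _) (sym (ℕ.+-assoc (costᶜ a) _ _))
                      (r (λ _ → let u , h , u≤ = onTrue refl in u , h , ℕ.≤-trans u≤ (ℕ.m≤n+m m _)) λ ())
  ... | false | r = subst (Halts _ _ _) (sym (ℕ.+-assoc (costᶜ a) _ _))
                      (r (λ ()) λ _ → branch-⇓ b onTrue onFalse)
  branch-⇓ (not a) {p} {q} {s} {s₁} {s₂} {m} onTrue onFalse
    with does (holds? a s) | branch-⇓ a {q} {p} {s} {s₂} {s₁} {m}
  ... | true  | r = r (λ _ → onFalse refl) λ ()
  ... | false | r = r (λ ()) λ _ → onTrue refl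

  not-true : ∀ {x} → Bool.not x ≡ true → x ≡ false
  not-true {false} _ = refl

  -- The bound is a polynomial in the number of jobs found in the initial state. As array 0 is never
  -- written, every later part of the run sees the same number, and the bounds compose.
  compile-⇓ : ∀ b → loopsIntact b ≡ true → writes 0 b ≡ false → ∀ s →
              Halts (compile b) s (exec b s) (evalPoly (time b) (nats s 0 0))
  compile-⇓ skip          ok 0∉ s = _ , skip , s≤s z≤n
  compile-⇓ (setᴺ k i e)  ok 0∉ s = _ , setᴺ , ℕ.m≤m+n _ _
  compile-⇓ (setᵂ k i e)  ok 0∉ s = _ , setᵂ , ℕ.m≤m+n _ _
  compile-⇓ (b ⨾ c)       ok 0∉ s =
    let 0∉b = ∨-conicalˡ (writes 0 b) _ 0∉
        t , run , t≤ = compile-⇓ b (∧-conicalˡ (loopsIntact b) _ ok) 0∉b s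
        u , run′ , u≤ = compile-⇓ c (∧-conicalʳ (loopsIntact b) _ ok) (∨-conicalʳ (writes 0 b) _ 0∉) (exec b s)
        u≤′ = subst (λ n → u ℕ.≤ evalPoly (time c) n) (frame 0 b s 0 0∉b) u≤
    in _ , run ⨾ run′ ,
       ℕ.≤-trans (ℕ.+-mono-≤ t≤ u≤′) (ℕ.≤-reflexive (sym (evalPoly-⊕ (time b) (time c) _)))
  compile-⇓ (if a b c)    ok 0∉ s =
    let n = nats s 0 0
        tb = evalPoly (time b) n
        tc = evalPoly (time c) n
        t , run , t≤ = branch-⇓ a {m = tb ℕ.+ tc}
          (λ _ → let t , run , t≤ = compile-⇓ b (∧-conicalˡ (loopsIntact b) _ ok) (∨-conicalˡ (writes 0 b) _ 0∉) s
                 in t , run , ℕ.≤-trans t≤ (ℕ.m≤m+n _ _))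
          (λ _ → let t , run , t≤ = compile-⇓ c (∧-conicalʳ (loopsIntact b) _ ok) (∨-conicalʳ (writes 0 b) _ 0∉) s
                 in t , run , ℕ.≤-trans t≤ (ℕ.m≤n+m _ _))
    in t , run , ℕ.≤-trans t≤ (ℕ.≤-reflexive (sym (trans
         (evalPoly-⊕ (costᶜ a ∷ []) (time b ⊕ time c) n)
         (cong₂ ℕ._+_ (trans (cong (costᶜ a ℕ.+_) (ℕ.*-zeroʳ n)) (ℕ.+-identityʳ _)) (evalPoly-⊕ (time b) (time c) n)))))
  compile-⇓ (loop v b)    ok 0∉ s =
    let n = nats s 0 0
        t , run , t≤ = go 0 (suc n) n (assign v 0 s) (ℕ.+-identityʳ _) (write-hit (nats s) v 0 0) (write-other (nats s) v 0 0 0 v≢0)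
    in _ , setᴺ ⨾ run , ℕ.≤-trans (ℕ.+-monoʳ-≤ 3 t≤) (ℕ.≤-reflexive (bound n))
    where
    open ℕ.≤-Reasoning hiding (stop)
    v≢0 = ∨-conicalˡ (does (v ℕ.≟ 0)) _ 0∉
    0∉b = ∨-conicalʳ (does (v ℕ.≟ 0)) _ 0∉
    v∉b = not-true (∧-conicalˡ (Bool.not (writes v b)) _ ok)
    okb = ∧-conicalʳ (Bool.not (writes v b)) _ ok
    loopTest = var v ≤ᴺ var 0
    body = compile b ⨾ increment v

    bound : ∀ n → 3 ℕ.+ (suc n ℕ.* (11 ℕ.+ evalPoly (time b) n) ℕ.+ 5) ≡ evalPoly (time (loop v b)) n
    bound n = begin-equality
      3 ℕ.+ (suc n ℕ.* r ℕ.+ 5)        ≡⟨ cong (3 ℕ.+_) (ℕ.+-comm _ 5) ⟩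
      8 ℕ.+ suc n ℕ.* r                ≡⟨ cong₂ ℕ._+_ (cong (8 ℕ.+_) (sym (ℕ.*-zeroʳ n))) (cong (λ r → r ℕ.+ n ℕ.* r) (sym rnd)) ⟩
      (8 ℕ.+ n ℕ.* 0) ℕ.+ (evalPoly round n ℕ.+ evalPoly (0 ∷ round) n)
        ≡⟨ cong ((8 ℕ.+ n ℕ.* 0) ℕ.+_) (sym (evalPoly-⊕ round (0 ∷ round) n)) ⟩
      evalPoly (8 ∷ []) n ℕ.+ evalPoly (round ⊕ (0 ∷ round)) n
        ≡⟨ sym (evalPoly-⊕ (8 ∷ []) (round ⊕ (0 ∷ round)) n) ⟩
      evalPoly (time (loop v b)) n ∎
      where
      r = 11 ℕ.+ evalPoly (time b) n
      round = (11 ∷ []) ⊕ time b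
      rnd : evalPoly round n ≡ r
      rnd = trans (evalPoly-⊕ (11 ∷ []) (time b) n)
                  (cong (λ x → 11 ℕ.+ x ℕ.+ evalPoly (time b) n) (ℕ.*-zeroʳ n))

    go : ∀ i k n s → k ℕ.+ i ≡ suc n → nats s v 0 ≡ i → nats s 0 0 ≡ n →
         Halts (while loopTest body) s (iterateFrom (exec b) v i k s)
               (k ℕ.* (11 ℕ.+ evalPoly (time b) n) ℕ.+ 5)
    go i zero n s refl vi 0n = _ , stop (dec-false (nats s v 0 ℕ.≤? nats s 0 0)
      λ v≤0 → ℕ.n≮n n (subst₂ ℕ._≤_ vi 0n v≤0)) , ℕ.≤-refl
    go i (suc k) n s eq refl refl =
      let t , run , t≤ = compile-⇓ b okb 0∉b s
          s′ = exec b s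
          v-kept : nats s′ v 0 ℕ.+ 1 ≡ suc i
          v-kept = trans (cong (ℕ._+ 1) (frame v b s 0 v∉b)) (ℕ.+-comm i 1)
          u , run′ , u≤ = go (suc i) k n (assign v (suc i) s′) (trans (ℕ.+-suc k i) eq)
            (write-hit (nats s′) v 0 (suc i))
            (trans (write-other (nats s′) v 0 (suc i) 0 v≢0) (frame 0 b s 0 0∉b))
          step : increment v ⊢ s′ ⇓ assign v (suc i) s′ # 6
          step = subst (λ x → increment v ⊢ s′ ⇓ assign v x s′ # 6) v-kept setᴺ
      in _ , iterate (dec-true (i ℕ.≤? n) (ℕ.≤-trans (ℕ.m≤n+m i k) (ℕ.≤-reflexive (ℕ.suc-injective eq))))
                     (run ⨾ step) run′ , (begin
        5 ℕ.+ (t ℕ.+ 6) ℕ.+ u   ≤⟨ ℕ.+-mono-≤ (ℕ.+-monoʳ-≤ 5 (ℕ.+-monoˡ-≤ 6 t≤)) u≤ ⟩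
        5 ℕ.+ (T n ℕ.+ 6) ℕ.+ (k ℕ.* r ℕ.+ 5)   ≡⟨ cong (λ x → 5 ℕ.+ x ℕ.+ (k ℕ.* r ℕ.+ 5)) (ℕ.+-comm (T n) 6) ⟩
        r ℕ.+ (k ℕ.* r ℕ.+ 5)   ≡⟨ sym (ℕ.+-assoc r _ 5) ⟩
        suc k ℕ.* r ℕ.+ 5       ∎)
      where
      T = evalPoly (time b)
      r = 11 ℕ.+ T n

  -- Specifications mention the final state as a variable: exec b s would be
  -- unfolded by the type checker.

  infix 4 _⊢_↦_

  data _⊢_↦_ (b : Code) (s : State) : State → Set c where
    run : b ⊢ s ↦ exec b s

  ⨾-inv : ∀ {b c s s″} → b ⨾ c ⊢ s ↦ s″ → ∃[ s′ ] (b ⊢ s ↦ s′) × (c ⊢ s′ ↦ s″)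
  ⨾-inv run = _ , run , run

  if-inv : ∀ {a b c s s′} → if a b c ⊢ s ↦ s′ →
    (holds a s × (b ⊢ s ↦ s′)) ⊎ (¬ holds a s × (c ⊢ s ↦ s′))
  if-inv {a} {b} {c} {s} run with holds? a s
  ... | yes h = inj₁ (h , run)
  ... | no ¬h = inj₂ (¬h , run)

  module _ {ℓ} v b (J : ℕ → State → Set ℓ) (n : ℕ)
           (stable : ∀ {i} x {s} → J i s → J i (assign v x s))
           (body : ∀ i {s s′} → i ℕ.≤ n → nats s v 0 ≡ i → b ⊢ s ↦ s′ → J i s → J (suc i) s′) where

    -- The counter is reassigned between rounds, so by `stable` an invariant has to be insensitive
    -- to `v`; the value of the counter reaches `body` as a separate hypothesis.
    loop-invariant : ∀ {s s′} → loop v b ⊢ s ↦ s′ → nats s 0 0 ≡ n → J 0 s → J (suc n) s′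
    loop-invariant {s} run refl j = go 0 (suc n) (ℕ.+-identityʳ _) (write-hit (nats s) v 0 0) (stable 0 j)
      where
      go : ∀ i k {s} → k ℕ.+ i ≡ suc n → nats s v 0 ≡ i → J i s →
           J (suc n) (iterateFrom (exec b) v i k s)
      go i zero    refl vi j = j
      go i (suc k) {s} eq   vi j = go (suc i) k (trans (ℕ.+-suc k i) eq) (write-hit (nats (exec b s)) v 0 (suc i))
        (stable (suc i) (body i (ℕ.≤-trans (ℕ.m≤n+m i k) (ℕ.≤-reflexive (ℕ.suc-injective eq))) vi run j))

  module _ {ℓ ℓ′ ℓ″} v b {_⊑_ : State → State → Set ℓ}
           (⊑-refl : ∀ {s} → s ⊑ s) (⊑-trans : ∀ {s s′ s″} → s ⊑ s′ → s′ ⊑ s″ → s ⊑ s″)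
           (P : State → Set ℓ′) (F : ℕ → State → Set ℓ″)
           (F-mono : ∀ {i s s′} → s ⊑ s′ → F i s → F i s′) (n : ℕ)
           (stable : ∀ x {s} → P s → P (assign v x s) × s ⊑ assign v x s)
           (body : ∀ i {s s′} → i ℕ.≤ n → nats s v 0 ≡ i → b ⊢ s ↦ s′ → P s →
                   P s′ × s ⊑ s′ × F i s′) where

    -- What round `i` establishes must survive the later rounds. It does because all rounds move
    -- upwards in the preorder `_⊑_` and `F i` is monotone.
    loop-forall : ∀ {s s′} → loop v b ⊢ s ↦ s′ → nats s 0 0 ≡ n → P s →
                  P s′ × s ⊑ s′ × (∀ i → i ℕ.≤ n → F i s′)
    loop-forall {s₀} r 0n p =
      let p′ , ⊑′ , f = loop-invariant v b J n stableJ bodyJ r 0n (p , ⊑-refl , λ _ ())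
      in p′ , ⊑′ , λ i i≤n → f i (s≤s i≤n)
      where
      J : ℕ → State → Set _
      J i s = P s × s₀ ⊑ s × (∀ j → j ℕ.< i → F j s)

      stableJ : ∀ {i} x {s} → J i s → J i (assign v x s)
      stableJ x (p , ⊑s , f) = let p′ , ⊑′ = stable x p in
        p′ , ⊑-trans ⊑s ⊑′ , λ j j<i → F-mono ⊑′ (f j j<i)

      extend : ∀ {i s} → F i s → (∀ j → j ℕ.< i → F j s) → ∀ j → j ℕ.< suc i → F j s
      extend fi f j (s≤s j≤i) with ℕ.m≤n⇒m<n∨m≡n j≤i
      ... | inj₁ j<i  = f j j<i
      ... | inj₂ refl = fi

      bodyJ : ∀ i {s s′} → i ℕ.≤ n → nats s v 0 ≡ i → b ⊢ s ↦ s′ → J i s → J (suc i) s′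
      bodyJ i i≤n vi r (p , ⊑s , f) = let p′ , ⊑′ , fi = body i i≤n vi r p in
        p′ , ⊑-trans ⊑s ⊑′ , extend fi (λ j j<i → F-mono ⊑′ (f j j<i))

-- Subsets and sums over subsets

x∉p-x : ∀ {n} {x : Fin n} {p} → x ∉ p - x
x∉p-x {x = zero}  {_ ∷ p} ()
x∉p-x {x = suc x} {_ ∷ p} (there x∈) = x∉p-x x∈

x∈p-y⇒x∈p : ∀ {n} {x y : Fin n} {p} → x ∈ p - y → x ∈ p
x∈p-y⇒x∈p {y = y} {p} = p─q⊆p p ⁅ y ⁆

x∈p-y⇒x≢y : ∀ {n} {x y : Fin n} {p} → x ∈ p - y → x ≢ y
x∈p-y⇒x≢y x∈ refl = x∉p-x x∈

[p-x]∪x≡p : ∀ {n} {x : Fin n} {p} → x ∈ p → (p - x) ∪ ⁅ x ⁆ ≡ p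
[p-x]∪x≡p {x = x} {p} x∈p = ⊆-antisym fro to
  where
  fro : (p - x) ∪ ⁅ x ⁆ ⊆ p
  fro y∈ with x∈p∪q⁻ (p - x) ⁅ x ⁆ y∈
  ... | inj₁ y∈p-x = x∈p-y⇒x∈p y∈p-x
  ... | inj₂ y∈x   = subst (_∈ p) (sym (x∈⁅y⁆⇒x≡y x y∈x)) x∈p
  to : p ⊆ (p - x) ∪ ⁅ x ⁆
  to {y} y∈p with y Fin.≟ x
  ... | yes refl = x∈p∪q⁺ (inj₂ (x∈⁅x⁆ y))
  ... | no y≢x   = x∈p∪q⁺ (inj₁ (x∈p∧x≢y⇒x∈p-y y∈p y≢x))

p-x≡p : ∀ {n} {x : Fin n} {p} → x ∉ p → p - x ≡ p
p-x≡p {x = x} {p} x∉p = ⊆-antisym (p─q⊆p p ⁅ x ⁆)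
  λ y∈p → x∈p∧x≢y⇒x∈p-y y∈p λ { refl → x∉p y∈p }

module SubsetSum {a ℓ} (M : CommutativeMonoid a ℓ) where

  open CommutativeMonoid M
    renaming (_∙_ to _+_; ε to 0#; identityˡ to +-identityˡ; ∙-congˡ to +-congˡ; comm to +-comm; assoc to +-assoc)
  open RawMonoidOps rawMonoid using (sum)
  open SetoidReasoning setoid

  -- Used with two monoids: over the weights, `∑∈ S (weight ∘ job I)` is `w I S` by definition; over
  -- the naturals it gives the encodings of sets.
  ∑∈ : ∀ {n} → Subset n → (Fin n → Carrier) → Carrier
  ∑∈ S g = sum λ i → if lookup S i then g i else 0#

  ∑∈-⊥ : ∀ {n} (g : Fin n → Carrier) → ∑∈ ⊥ g ≈ 0#
  ∑∈-⊥ {zero}  g = CommutativeMonoid.refl M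
  ∑∈-⊥ {suc n} g = CommutativeMonoid.trans M (+-identityˡ _) (∑∈-⊥ (g ∘ suc))

  ∑∈-insert : ∀ {n} {S : Subset n} {x} (g : Fin n → Carrier) → x ∉ S → ∑∈ (S ∪ ⁅ x ⁆) g ≈ ∑∈ S g + g x
  ∑∈-insert {S = inside  ∷ S} {zero}  g x∉ = contradiction here x∉
  ∑∈-insert {S = outside ∷ S} {zero}  g x∉ = begin
    g zero + ∑∈ (S ∪ ⊥) (g ∘ suc)    ≡⟨ cong (λ T → g zero + ∑∈ T (g ∘ suc)) (∪-identityʳ S) ⟩
    g zero + ∑∈ S (g ∘ suc)          ≈⟨ +-comm _ _ ⟩
    ∑∈ S (g ∘ suc) + g zero          ≈⟨ CommutativeMonoid.∙-congʳ M (CommutativeMonoid.sym M (+-identityˡ _)) ⟩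
    0# + ∑∈ S (g ∘ suc) + g zero     ∎
  ∑∈-insert {S = inside  ∷ S} {suc x} g x∉ = begin
    g zero + ∑∈ (S ∪ ⁅ x ⁆) (g ∘ suc)      ≈⟨ +-congˡ (∑∈-insert (g ∘ suc) (x∉ ∘ there)) ⟩
    g zero + (∑∈ S (g ∘ suc) + g (suc x))  ≈⟨ +-assoc _ _ _ ⟨
    g zero + ∑∈ S (g ∘ suc) + g (suc x)    ∎
  ∑∈-insert {S = outside ∷ S} {suc x} g x∉ = begin
    0# + ∑∈ (S ∪ ⁅ x ⁆) (g ∘ suc)          ≈⟨ +-congˡ (∑∈-insert (g ∘ suc) (x∉ ∘ there)) ⟩
    0# + (∑∈ S (g ∘ suc) + g (suc x))      ≈⟨ +-assoc _ _ _ ⟨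
    0# + ∑∈ S (g ∘ suc) + g (suc x)        ∎

-- Ordered abelian groups

module OrderedGroupProperties {c ℓ₁ ℓ₂} (R : OrderedAbelianGroup c ℓ₁ ℓ₂) where

  open OrderedAbelianGroup R
  open AbelianGroup abelianGroup public
    using (setoid; commutativeMonoid; commutativeSemigroup)
    renaming ( sym to ≈-sym; trans to ≈-trans; reflexive to ≈-reflexive
             ; comm to +-comm; assoc to +-assoc; identityˡ to +-identityˡ; identityʳ to +-identityʳ
             ; inverseˡ to -‿inverseˡ; inverseʳ to -‿inverseʳ; ∙-congˡ to +-congˡ; ∙-congʳ to +-congʳ)
  open DecTotalOrder decTotalOrder public
    using (poset) renaming (refl to ≤-refl; trans to ≤-trans; reflexive to ≤-reflexive; total to ≤-total)
  open PosetReasoning poset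

  +-monoˡ-≤ : ∀ x {y z} → y ≤ z → y + x ≤ z + x
  +-monoˡ-≤ x {y} {z} y≤z = begin
    y + x  ≈⟨ +-comm y x ⟩
    x + y  ≤⟨ +-monoʳ-≤ x y≤z ⟩
    x + z  ≈⟨ +-comm x z ⟩
    z + x  ∎

  [-x]+[x+y]≈y : ∀ x y → - x + (x + y) ≈ y
  [-x]+[x+y]≈y x y = ≈-trans (≈-sym (+-assoc _ _ _)) (≈-trans (+-congʳ (-‿inverseˡ x)) (+-identityˡ y))

  +-cancelˡ-≤ : ∀ x {y z} → x + y ≤ x + z → y ≤ z
  +-cancelˡ-≤ x {y} {z} le = begin
    y              ≈⟨ [-x]+[x+y]≈y x y ⟨
    - x + (x + y)  ≤⟨ +-monoʳ-≤ (- x) le ⟩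
    - x + (x + z)  ≈⟨ [-x]+[x+y]≈y x z ⟩
    z              ∎

  +-cancelʳ-≤ : ∀ x {y z} → y + x ≤ z + x → y ≤ z
  +-cancelʳ-≤ x {y} {z} le = +-cancelˡ-≤ x (begin
    x + y  ≈⟨ +-comm x y ⟩
    y + x  ≤⟨ le ⟩
    z + x  ≈⟨ +-comm z x ⟩
    x + z  ∎)

-- Disjointness as an order, exchange of jobs, robust value

module Scheduling {c ℓ₁ ℓ₂} (R : OrderedAbelianGroup c ℓ₁ ℓ₂) (I : RIS.Jobs R) where

  open OrderedAbelianGroup R
  open OrderedGroupProperties R
  open RIS R
  open SubsetSum commutativeMonoid

  n : ℕ
  n = count I

  private
    variable
      i j k : Fin n
      S : Subset n
      f : Maybe (Fin n)

  -- Nonempty jobs are shifted by n and the empty job i is moved to [i, i + 1),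
  -- so that disjointness of distinct jobs becomes comparability.

  empty? : ∀ i → Dec (end (job I i) ℕ.≤ start (job I i))
  empty? i = end (job I i) ℕ.≤? start (job I i)

  lo hi : Fin n → ℕ
  lo i with empty? i
  ... | yes _ = toℕ i
  ... | no _  = n ℕ.+ start (job I i)
  hi i with empty? i
  ... | yes _ = suc (toℕ i)
  ... | no _  = n ℕ.+ end (job I i)

  infix 4 _≺_ _⊲_ _~_

  _≺_ : Fin n → Fin n → Set
  i ≺ j = hi i ℕ.≤ lo j

  lo<hi : ∀ i → lo i ℕ.< hi i
  lo<hi i with empty? i
  ... | yes _ = ℕ.≤-refl
  ... | no e≰ = ℕ.+-monoʳ-< n (ℕ.≰⇒> e≰)

  ≺-trans : i ≺ j → j ≺ k → i ≺ k
  ≺-trans {j = j} i≺j j≺k = ℕ.≤-trans i≺j (ℕ.≤-trans (ℕ.<⇒≤ (lo<hi j)) j≺k)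

  ≺-irrefl : ¬ (i ≺ i)
  ≺-irrefl {i} i≺i = ℕ.<⇒≱ (lo<hi i) i≺i

  Comparable : Fin n → Fin n → Set
  Comparable i j = i ≺ j ⊎ j ≺ i

  private
    ¬interval : ∀ {j x} → end j ℕ.≤ start j → ¬ interval j x
    ¬interval e≤s (s≤x , x<e) = ℕ.<⇒≱ (ℕ.≤-<-trans s≤x x<e) e≤s

  ≺⇒disjoint : i ≺ j → Disjoint (job I i) (job I j)
  ≺⇒disjoint {i} {j} i≺j (iᵢ , iⱼ) with empty? i | empty? j
  ... | yes ∅ | _     = ¬interval {job I i} ∅ iᵢ
  ... | no _  | yes ∅ = ¬interval {job I j} ∅ iⱼ
  ... | no _  | no _  = ℕ.<⇒≱ (ℕ.≤-<-trans (proj₁ iⱼ) (proj₂ iᵢ)) (ℕ.+-cancelˡ-≤ n _ _ i≺j)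

  comparable⇒disjoint : Comparable i j → Disjoint (job I i) (job I j)
  comparable⇒disjoint (inj₁ i≺j) = ≺⇒disjoint i≺j
  comparable⇒disjoint (inj₂ j≺i) (x , y) = ≺⇒disjoint j≺i (y , x)

  -- Empty jobs are ordered by their distinct numbers, all below `n`, and nonempty jobs lie above
  -- `n`. If of two nonempty jobs neither ends before the other starts, the later of their starts is
  -- a common point.
  disjoint⇒comparable : i ≢ j → Disjoint (job I i) (job I j) → Comparable i j
  disjoint⇒comparable {i} {j} i≢j disj with empty? i | empty? j
  ... | yes _ | yes _ = ≢⇒<⊎> (i≢j ∘ Fin.toℕ-injective)
    where
    ≢⇒<⊎> : ∀ {x y} → x ≢ y → x ℕ.< y ⊎ y ℕ.< x
    ≢⇒<⊎> {x} {y} x≢y with ℕ.<-cmp x y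
    ... | tri< x<y _ _ = inj₁ x<y
    ... | tri≈ _ x≡y _ = contradiction x≡y x≢y
    ... | tri> _ _ y<x = inj₂ y<x
  ... | yes _ | no _  = inj₁ (ℕ.≤-trans (Fin.toℕ<n i) (ℕ.m≤m+n n _))
  ... | no _  | yes _ = inj₂ (ℕ.≤-trans (Fin.toℕ<n j) (ℕ.m≤m+n n _))
  ... | no sᵢ | no sⱼ with end (job I i) ℕ.≤? start (job I j) | end (job I j) ℕ.≤? start (job I i)
  ...   | yes ≤s | _      = inj₁ (ℕ.+-monoʳ-≤ n ≤s)
  ...   | no _   | yes ≤s = inj₂ (ℕ.+-monoʳ-≤ n ≤s)
  ...   | no ij  | no ji  = ⊥-elim (disj
    ( (ℕ.m≤m⊔n (start (job I i)) (start (job I j)) , ℕ.⊔-lub (ℕ.≰⇒> sᵢ) (ℕ.≰⇒> ij))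
    , (ℕ.m≤n⊔m (start (job I i)) (start (job I j)) , ℕ.⊔-lub (ℕ.≰⇒> ji) (ℕ.≰⇒> sⱼ))))

  Chain : Subset n → Set
  Chain S = ∀ {i j} → i ∈ S → j ∈ S → i ≢ j → Comparable i j

  feasible⇒chain : Feasible I S → Chain S
  feasible⇒chain feas i∈S j∈S i≢j = disjoint⇒comparable i≢j (feas _ _ i∈S j∈S i≢j)

  chain⇒feasible : Chain S → Feasible I S
  chain⇒feasible chain i j i∈S j∈S i≢j = comparable⇒disjoint (chain i∈S j∈S i≢j)

  -- A member with the largest `lo` is last, since a job after it would have a larger `lo`.
  greatest : Chain S → Nonempty S → ∃[ q ] q ∈ S × (∀ {i} → i ∈ S → i ≢ q → i ≺ q)
  greatest {S} chain (x , x∈S) = top , top∈S , ≺top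
    where
    open Extrema ℕ.≤-totalOrder using (argmax; argmax-all; f[xs]≤f[argmax])
    members = filter (_∈? S) (allFin n)
    top = argmax lo x members

    top∈S : top ∈ S
    top∈S = argmax-all lo {P = _∈ S} {xs = members} x∈S (All.all-filter (_∈? S) (allFin n))

    lo≤ : i ∈ S → lo i ℕ.≤ lo top
    lo≤ {i} i∈S = All.lookup (f[xs]≤f[argmax] x members) (∈-filter⁺ (_∈? S) (∈-allFin i) i∈S)

    ≺top : i ∈ S → i ≢ top → i ≺ top
    ≺top i∈S i≢top with chain i∈S top∈S i≢top
    ... | inj₁ i≺top = i≺top
    ... | inj₂ top≺i = contradiction (ℕ.<-≤-trans (ℕ.<-≤-trans (lo<hi top) top≺i) (lo≤ i∈S)) (ℕ.n≮n _)

  -- nothing lies before and after every job: it serves both as the job ∅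
  -- and as the two ends of a chain.  Hence _⊲_ is transitive only through
  -- proper jobs.

  _⊲_ : Maybe (Fin n) → Maybe (Fin n) → Set
  nothing ⊲ _       = ⊤
  just _  ⊲ nothing = ⊤
  just i  ⊲ just j  = i ≺ j

  _~_ : Maybe (Fin n) → Maybe (Fin n) → Set
  a ~ b = a ⊲ b ⊎ b ⊲ a

  ⊲-nothing : ∀ a → a ⊲ nothing
  ⊲-nothing nothing  = tt
  ⊲-nothing (just _) = tt

  ⊲-trans : ∀ a b → a ⊲ just j → just j ⊲ b → a ⊲ b
  ⊲-trans nothing  b        _   _   = tt
  ⊲-trans (just _) nothing  _   _   = tt
  ⊲-trans (just _) (just _) i≺j j≺k = ≺-trans i≺j j≺k

  weightOf : Maybe (Fin n) → Carrier
  weightOf nothing  = 0#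
  weightOf (just i) = weight (job I i)

  infix 4 _∉∙_

  _∉∙_ : Maybe (Fin n) → Subset n → Set
  nothing ∉∙ S = ⊤
  just i  ∉∙ S = i ∉ S

  w-∪∙ : ∀ e → e ∉∙ S → w I (_∪∙_ I S e) ≈ w I S + weightOf e
  w-∪∙ nothing  _   = ≈-sym (+-identityʳ _)
  w-∪∙ (just e) e∉S = ∑∈-insert (weight ∘ job I) e∉S

  w-∖ : i ∈ S → w I (S - i) + weight (job I i) ≈ w I S
  w-∖ {i} {S} i∈S = ≈-trans (≈-sym (∑∈-insert (weight ∘ job I) (x∉p-x {p = S})))
    (≈-reflexive (cong (w I) ([p-x]∪x≡p i∈S)))

  ∖-∉∙ : ∀ f → f ∉∙ S → _∖_ I S f ≡ S
  ∖-∉∙ nothing  _   = refl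
  ∖-∉∙ (just f) f∉S = p-x≡p f∉S

  w-exchange : ∀ e → f ∉∙ S → e ∉∙ S → w I (_∪∙_ I (_∖_ I S f) e) ≈ w I S + weightOf e
  w-exchange {f} {S} e f∉S e∉S rewrite ∖-∉∙ {S} f f∉S = w-∪∙ e e∉S

  w-exchange-∈ : ∀ e → i ∈ S → e ∉∙ (S - i) →
                 w I (_∪∙_ I (S - i) e) + weight (job I i) ≈ w I S + weightOf e
  w-exchange-∈ {i} {S} e i∈S e∉S = begin
    w I (_∪∙_ I (S - i) e) + wᵢ     ≈⟨ +-congʳ (w-∪∙ e e∉S) ⟩
    w I (S - i) + weightOf e + wᵢ   ≈⟨ xy∙z≈xz∙y _ _ _ ⟩
    w I (S - i) + wᵢ + weightOf e   ≈⟨ +-congʳ (w-∖ i∈S) ⟩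
    w I S + weightOf e              ∎
    where
    open SetoidReasoning setoid
    open CommutativeSemigroupProperties commutativeSemigroup using (xy∙z≈xz∙y)
    wᵢ = weight (job I i)

  Admissible : Subset n → Maybe (Fin n) → Maybe (Fin n) → Set
  Admissible S f nothing  = ⊤
  Admissible S f (just e) = Addable I S f e

  open Extrema totalOrder using (⊥≤max; xs≤max; argmax-sel; argmin-sel; min≤⊤; min≤xs; v≤min⁺)

  recoveries : Subset n → Maybe (Fin n) → List Carrier
  recoveries S f = map (λ e → w I (_∪∙_ I (_∖_ I S f) (just e))) (filter (addable? I S f) (allFin n))

  admissible≤recovered : ∀ e → Admissible S f e → w I (_∪∙_ I (_∖_ I S f) e) ≤ recovered I S f
  admissible≤recovered {S} {f} nothing  _   = ⊥≤max _ (recoveries S f)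
  admissible≤recovered {S} {f} (just e) adm = All.lookup (xs≤max _ (recoveries S f))
    (∈-map⁺ _ (∈-filter⁺ (addable? I S f) (∈-allFin e) adm))

  recovered-attained : ∀ S f → ∃[ e ] Admissible S f e × recovered I S f ≡ w I (_∪∙_ I (_∖_ I S f) e)
  recovered-attained S f with argmax-sel id (w I (_∖_ I S f)) (recoveries S f)
  ... | inj₁ eq  = nothing , tt , eq
  ... | inj₂ max∈ = let e , e∈ , eq = ∈-map⁻ _ max∈ in
                    just e , proj₂ (∈-filter⁻ (addable? I S f) {xs = allFin n} e∈) , eq

  robustValue≤recovered : ∀ S f → robustValue I S ≤ recovered I S f
  robustValue≤recovered S nothing  = min≤⊤ _ (map (recovered I S ∘ just) (allFin n))
  robustValue≤recovered S (just f) = All.lookup (min≤xs (recovered I S nothing) _) (∈-map⁺ _ (∈-allFin f))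

  robustValue-attained : ∀ S → ∃[ f ] robustValue I S ≡ recovered I S f
  robustValue-attained S with argmin-sel id (recovered I S nothing) (map (recovered I S ∘ just) (allFin n))
  ... | inj₁ eq   = nothing , eq
  ... | inj₂ min∈ = let f , _ , eq = ∈-map⁻ _ min∈ in just f , eq

  ≤robustValue : ∀ {v} → (∀ f → v ≤ recovered I S f) → v ≤ robustValue I S
  ≤robustValue v≤ = v≤min⁺ (v≤ nothing) (All.map⁺ (All.universal (v≤ ∘ just) (allFin n)))

  ∈∖ : ∀ f → i ∈ S → just i ≢ f → i ∈ _∖_ I S f
  ∈∖ nothing  i∈S _   = i∈S
  ∈∖ (just f) i∈S i≢f = x∈p∧x≢y⇒x∈p-y i∈S (i≢f ∘ cong just)

  ∈∖⇒∈ : ∀ f → i ∈ _∖_ I S f → i ∈ S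
  ∈∖⇒∈ nothing  i∈ = i∈
  ∈∖⇒∈ (just f) i∈ = x∈p-y⇒x∈p i∈

  ∈∖⇒≢ : ∀ f → i ∈ _∖_ I S f → just i ≢ f
  ∈∖⇒≢ (just f) i∈ refl = x∉p-x i∈

  ~-irrefl : ¬ (just i ~ just i)
  ~-irrefl (inj₁ i≺i) = ≺-irrefl i≺i
  ~-irrefl (inj₂ i≺i) = ≺-irrefl i≺i

  -- The order-theoretic form of `Admissible`. For a chain the two agree except when `e` is the
  -- deleted job itself, which the side condition `e ≢ f ⊎ e ≡ nothing` below excludes.
  Fits : Subset n → Maybe (Fin n) → Maybe (Fin n) → Set
  Fits S f e = ∀ {i} → i ∈ S → just i ≢ f → just i ~ e

  module _ (chain : Chain S) where

    -- A member of `S` other than `f` that fits would be comparable with itself.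
    fits⇒∉ : ∀ e → e ≢ f ⊎ e ≡ nothing → Fits S f e → e ∉∙ S
    fits⇒∉ nothing  _            _    = tt
    fits⇒∉ (just e) (inj₁ e≢f) fits e∈S = ~-irrefl (fits e∈S e≢f)

    fits⇒admissible : ∀ e → e ≢ f ⊎ e ≡ nothing → Fits S f e → Admissible S f e
    fits⇒admissible nothing  _          _    = tt
    fits⇒admissible {f} (just e) (inj₁ e≢f) fits = e∉S∪f f e≢f , chain⇒feasible chain′
      where
      e∉S = fits⇒∉ (just e) (inj₁ e≢f) fits

      e∉S∪f : ∀ f → just e ≢ f → e ∉ _∪∙_ I S f
      e∉S∪f nothing  e≢f e∈ = e∉S e∈
      e∉S∪f (just f) e≢f e∈ with x∈p∪q⁻ S ⁅ f ⁆ e∈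
      ... | inj₁ e∈S = e∉S e∈S
      ... | inj₂ e∈f = e≢f (cong just (x∈⁅y⁆⇒x≡y f e∈f))

      T = _∖_ I S f

      chain′ : Chain (T ∪ ⁅ e ⁆)
      chain′ i∈ j∈ i≢j with x∈p∪q⁻ T ⁅ e ⁆ i∈ | x∈p∪q⁻ T ⁅ e ⁆ j∈
      ... | inj₁ i∈T | inj₁ j∈T = chain (∈∖⇒∈ f i∈T) (∈∖⇒∈ f j∈T) i≢j
      ... | inj₁ i∈T | inj₂ j∈e rewrite x∈⁅y⁆⇒x≡y e j∈e = fits (∈∖⇒∈ f i∈T) (∈∖⇒≢ f i∈T)
      ... | inj₂ i∈e | inj₁ j∈T rewrite x∈⁅y⁆⇒x≡y e i∈e = swap (fits (∈∖⇒∈ f j∈T) (∈∖⇒≢ f j∈T))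
      ... | inj₂ i∈e | inj₂ j∈e = contradiction (trans (x∈⁅y⁆⇒x≡y e i∈e) (sym (x∈⁅y⁆⇒x≡y e j∈e))) i≢j

    admissible-fits : ∀ e → Admissible S f e → Fits S f e
    admissible-fits nothing  _ _ _ = inj₁ tt
    admissible-fits {f} (just e) (e∉ , feas) {i} i∈S i≢f = disjoint⇒comparable i≢e
      (feas i e (x∈p∪q⁺ (inj₁ (∈∖ f i∈S i≢f))) (x∈p∪q⁺ (inj₂ (x∈⁅x⁆ e))) i≢e)
      where
      S⊆S∪f : ∀ f → S ⊆ _∪∙_ I S f
      S⊆S∪f nothing  i∈ = i∈
      S⊆S∪f (just f) i∈ = x∈p∪q⁺ (inj₁ i∈)
      i≢e : i ≢ e
      i≢e refl = e∉ (S⊆S∪f f i∈S)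

-- Soundness of the local conditions

-- A chain S together with δ, e₁, e₂ certifies robust value ≥ w S + δ as follows.
-- e₁ and e₂ can be added to S and have weight ≥ δ, so that the deletion of a job
-- outside S is harmless, and every p ∈ S has a replacement of weight ≥ w p + δ,
-- which is e₁ or lies between the neighbours of p in S.

module Certificates {c ℓ₁ ℓ₂} (R : OrderedAbelianGroup c ℓ₁ ℓ₂) (I : RIS.Jobs R)
  (δ : OrderedAbelianGroup.Carrier R) (e₁ e₂ : Maybe (Fin (RIS.count I))) where

  open OrderedAbelianGroup R
  open OrderedGroupProperties R
  open RIS R
  open Scheduling R I

  private
    variable
      i j : Fin n
      m : ℕ
      S : Subset n
      e o p q : Maybe (Fin n)

  -- Required of all members of `S`, this makes `e₁` and `e₂` fit `S`; in particular they are not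
  -- members, as no job is comparable with itself.
  Allowed : Maybe (Fin n) → Set
  Allowed q = q ~ e₁ × q ~ e₂

  -- Moves the pair (o, p) to (p, q). The replacement `e` of `p` is checked only now because `q` is
  -- the first moment at which both neighbours are known. A step with `q = nothing` closes the
  -- chain. With `p = nothing` there is no job to replace, and `e₁` meets the conditions on `e`
  -- whenever `δ ≤ weightOf e₁`.
  record Step (o p q e : Maybe (Fin n)) : Set ℓ₂ where
    field
      ordered     : p ⊲ q
      allowed     : Allowed q
      local       : e ≡ e₁ ⊎ (e ≢ p × o ⊲ e × e ⊲ q)
      compensated : weightOf p + δ ≤ weightOf e

  open Step

  -- Reach m p q S: S is an initial segment of m jobs of a chain, with last two
  -- members p and q, all of whose members except q have replacements.

  data Reach : ℕ → Maybe (Fin n) → Maybe (Fin n) → Subset n → Set ℓ₂ where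
    base : Reach 0 nothing nothing ⊥
    step : ∀ {q} → Reach m o p S → Step o p (just q) e → Reach (suc m) p (just q) (S ∪ ⁅ q ⁆)

  infix 4 _≼_

  -- Unlike `_⊲_`, this never relates a job to `nothing`, and so it composes with `_⊲_` without
  -- exception.
  data _≼_ (i : Fin n) : Maybe (Fin n) → Set where
    ≼-refl : i ≼ just i
    ≺⇒≼    : i ≺ j → i ≼ just j

  -- `Fits` speaks of the prefix built so far; `e ⊲ q` takes care of what follows, since later
  -- members come after `q`.
  Replaces : Subset n → Maybe (Fin n) → Fin n → Maybe (Fin n) → Set
  Replaces S q f e = e ≡ e₁ ⊎ (e ≢ just f × Fits S (just f) e × e ⊲ q)

  record Invariant (p q : Maybe (Fin n)) (S : Subset n) : Set ℓ₂ where
    field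
      linked  : p ⊲ q
      p∈S     : p ≡ just i → i ∈ S
      q∈S     : q ≡ just i → i ∈ S
      empty   : q ≡ nothing → i ∉ S
      sorted  : i ∈ S → just i ≡ q ⊎ i ≼ p
      permits : i ∈ S → Allowed (just i)
      chain   : Chain S
      replace : i ∈ S → just i ≢ q → ∃[ e ] weight (job I i) + δ ≤ weightOf e × Replaces S q i e

  open Invariant

  ≼-⊲-trans : i ≼ p → p ⊲ q → just i ⊲ q
  ≼-⊲-trans           ≼-refl      p⊲q = p⊲q
  ≼-⊲-trans {q = q}   (≺⇒≼ i≺j)   p⊲q = ⊲-trans (just _) q i≺j p⊲q

  ≼-last : Invariant o p S → i ∈ S → i ≼ p
  ≼-last {p = nothing} inv i∈S = contradiction i∈S (inv .empty refl)
  ≼-last {p = just p}  inv i∈S with inv .sorted i∈S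
  ... | inj₁ refl = ≼-refl
  ... | inj₂ i≼o  = ≺⇒≼ (≼-⊲-trans i≼o (inv .linked))

  below : Invariant o p S → i ∈ S → p ⊲ q → just i ⊲ q
  below inv i∈S = ≼-⊲-trans (≼-last inv i∈S)

  -- Comparing `e` with the left neighbour `o` of `p` is enough: all remaining earlier members lie
  -- at or before `o`.
  before : Invariant o p S → i ∈ S → just i ≢ p → o ⊲ e → just i ~ e
  before inv i∈S i≢p o⊲e with inv .sorted i∈S
  ... | inj₁ i≡p = contradiction i≡p i≢p
  ... | inj₂ i≼o = inj₁ (≼-⊲-trans i≼o o⊲e)

  -- The new step provides for `p`. An earlier replacement is `e₁` or lies before `p`, and `p ⊲ q`
  -- then puts it before `q`.
  replacement : Invariant o p S → Step o p q e → i ∈ S →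
                ∃[ e ] weight (job I i) + δ ≤ weightOf e × Replaces S q i e
  replacement {p = nothing} inv st i∈S = contradiction i∈S (inv .empty refl)
  replacement {o} {just p} {S} {q} {e} {i} inv st i∈S with i Fin.≟ p
  ... | yes refl = e , st .compensated , rep (st .local)
    where
    rep : e ≡ e₁ ⊎ (e ≢ just i × o ⊲ e × e ⊲ q) → Replaces S q i e
    rep (inj₁ e≡e₁)              = inj₁ e≡e₁
    rep (inj₂ (e≢i , o⊲e , e⊲q)) = inj₂ (e≢i , (λ j∈S j≢i → before inv j∈S j≢i o⊲e) , e⊲q)
  ... | no i≢p with inv .replace i∈S (i≢p ∘ just-injective)
  ...   | e′ , w≤ , inj₁ e′≡e₁ = e′ , w≤ , inj₁ e′≡e₁
  ...   | e′ , w≤ , inj₂ (e′≢i , fits , e′⊲p) =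
          e′ , w≤ , inj₂ (e′≢i , fits , ⊲-trans e′ q e′⊲p (st .ordered))

  invariant : Reach m p q S → Invariant p q S
  invariant base = record
    { linked  = tt
    ; p∈S     = λ ()
    ; q∈S     = λ ()
    ; empty   = λ _ → ∉⊥
    ; sorted  = λ i∈ → contradiction i∈ ∉⊥
    ; permits = λ i∈ → contradiction i∈ ∉⊥
    ; chain   = λ i∈ → contradiction i∈ ∉⊥
    ; replace = λ i∈ → contradiction i∈ ∉⊥
    }
  invariant (step {o = o} {p} {S} {q = q} r st) = record
    { linked  = st .ordered
    ; p∈S     = λ { refl → x∈p∪q⁺ (inj₁ (inv .q∈S refl)) }
    ; q∈S     = λ { refl → q∈ }
    ; empty   = λ ()
    ; sorted  = λ i∈ → [ (λ i∈S → inj₂ (≼-last inv i∈S)) , (λ i≡q → inj₁ (cong just i≡q)) ]′ (split i∈)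
    ; permits = λ i∈ → [ inv .permits , (λ { refl → st .allowed }) ]′ (split i∈)
    ; chain   = chain′
    ; replace = replace′
    }
    where
    inv = invariant r
    q∈ = x∈p∪q⁺ {p = S} (inj₂ (x∈⁅x⁆ q))

    split : i ∈ S ∪ ⁅ q ⁆ → i ∈ S ⊎ i ≡ q
    split i∈ with x∈p∪q⁻ S ⁅ q ⁆ i∈
    ... | inj₁ i∈S = inj₁ i∈S
    ... | inj₂ i∈q = inj₂ (x∈⁅y⁆⇒x≡y q i∈q)

    chain′ : Chain (S ∪ ⁅ q ⁆)
    chain′ i∈ j∈ i≢j with split i∈ | split j∈
    ... | inj₁ i∈S  | inj₁ j∈S  = inv .chain i∈S j∈S i≢j
    ... | inj₁ i∈S  | inj₂ refl = inj₁ (below inv i∈S (st .ordered))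
    ... | inj₂ refl | inj₁ j∈S  = inj₂ (below inv j∈S (st .ordered))
    ... | inj₂ refl | inj₂ refl = contradiction refl i≢j

    replace′ : i ∈ S ∪ ⁅ q ⁆ → just i ≢ just q →
               ∃[ e ] weight (job I i) + δ ≤ weightOf e × Replaces (S ∪ ⁅ q ⁆) (just q) i e
    replace′ i∈ i≢q with split i∈
    ... | inj₂ refl = contradiction refl i≢q
    ... | inj₁ i∈S with replacement inv st i∈S
    ...   | e , w≤ , inj₁ e≡e₁ = e , w≤ , inj₁ e≡e₁
    ...   | e , w≤ , inj₂ (e≢i , fits , e⊲q) = e , w≤ , inj₂ (e≢i , fits′ , e⊲q)
      where
      fits′ : Fits (S ∪ ⁅ q ⁆) (just _) e
      fits′ j∈ j≢i with split j∈
      ... | inj₁ j∈S  = fits j∈S j≢i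
      ... | inj₂ refl = inj₂ e⊲q

  -- `e₂` answers the deletion of `e₁` and must therefore differ from it. If `e₁` is ∅, it cannot be
  -- taken away, and no second choice is called for.
  Valid : Set ℓ₂
  Valid = δ ≤ weightOf e₁ × δ ≤ weightOf e₂ × (e₁ ≢ e₂ ⊎ e₁ ≡ nothing)

  reach-∉ : ∀ {q} → Reach m o p S → p ⊲ just q → q ∉ S
  reach-∉ r p⊲q q∈S = ≺-irrefl (below (invariant r) q∈S p⊲q)

  module _ (valid : Valid) (inv : Invariant o p S) (st : Step o p nothing e) where

    private
      open PosetReasoning poset

      fits-e₁ : ∀ f → Fits S f e₁
      fits-e₁ f i∈S _ = proj₁ (inv .permits i∈S)

      fits-e₂ : ∀ f → Fits S f e₂
      fits-e₂ f i∈S _ = proj₂ (inv .permits i∈S)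

      outside-bound : ∀ f e → f ∉∙ S → e ≢ f ⊎ e ≡ nothing → Fits S f e → δ ≤ weightOf e →
                      w I S + δ ≤ recovered I S f
      outside-bound f e f∉S e≢f fits δ≤ = begin
        w I S + δ                      ≤⟨ +-monoʳ-≤ _ δ≤ ⟩
        w I S + weightOf e             ≈⟨ w-exchange e f∉S (fits⇒∉ (inv .chain) e e≢f fits) ⟨
        w I (_∪∙_ I (_∖_ I S f) e)     ≤⟨ admissible≤recovered e (fits⇒admissible (inv .chain) e e≢f fits) ⟩
        recovered I S f                ∎

      inside-bound : ∀ e → i ∈ S → e ≢ just i → Fits S (just i) e → weight (job I i) + δ ≤ weightOf e →
                     w I S + δ ≤ recovered I S (just i)
      inside-bound {i} e i∈S e≢i fits w≤ = +-cancelʳ-≤ wᵢ (begin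
        w I S + δ + wᵢ                 ≈⟨ +-assoc _ _ _ ⟩
        w I S + (δ + wᵢ)               ≈⟨ +-congˡ (+-comm δ wᵢ) ⟩
        w I S + (wᵢ + δ)               ≤⟨ +-monoʳ-≤ _ w≤ ⟩
        w I S + weightOf e             ≈⟨ w-exchange-∈ e i∈S (e∉ e (fits⇒∉ (inv .chain) e (inj₁ e≢i) fits)) ⟨
        w I (_∪∙_ I (S - i) e) + wᵢ    ≤⟨ +-monoˡ-≤ wᵢ (admissible≤recovered e (fits⇒admissible (inv .chain) e (inj₁ e≢i) fits)) ⟩
        recovered I S (just i) + wᵢ    ∎)
        where
        wᵢ = weight (job I i)
        e∉ : ∀ e → e ∉∙ S → e ∉∙ (S - i)
        e∉ nothing  _   = tt
        e∉ (just e) e∉S = e∉S ∘ x∈p-y⇒x∈p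

      ∅-bound : ∀ f → f ∉∙ S → w I S + δ ≤ recovered I S f
      ∅-bound f f∉S with ≡-dec Fin._≟_ e₁ f | proj₂ (proj₂ valid)
      ... | no e₁≢f  | _             = outside-bound f e₁ f∉S (inj₁ e₁≢f) (fits-e₁ f) (proj₁ valid)
      ... | yes refl | inj₁ e₁≢e₂    = outside-bound f e₂ f∉S (inj₁ (e₁≢e₂ ∘ sym)) (fits-e₂ f) (proj₁ (proj₂ valid))
      ... | yes refl | inj₂ e₁≡∅     = outside-bound f e₁ f∉S (inj₂ e₁≡∅) (fits-e₁ f) (proj₁ valid)

      recovered-bound : ∀ f → w I S + δ ≤ recovered I S f
      recovered-bound nothing  = ∅-bound nothing tt
      recovered-bound (just f) with f ∈? S
      ... | no f∉S  = ∅-bound (just f) f∉S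
      ... | yes f∈S with replacement inv st f∈S
      -- `e₁` may lie far from `f`, but it fits all of `S`; it differs from `f` because `f` is
      -- comparable with it.
      ...   | e , w≤ , inj₁ refl = inside-bound e₁ f∈S (λ { refl → ~-irrefl (proj₁ (inv .permits f∈S)) })
                                     (fits-e₁ (just f)) w≤
      ...   | e , w≤ , inj₂ (e≢f , fits , _) = inside-bound e f∈S e≢f fits w≤

    robustValue-bound : w I S + δ ≤ robustValue I S
    robustValue-bound = ≤robustValue recovered-bound

-- Every feasible set passes the local tests for some guess with exact value

module Completeness {c ℓ₁ ℓ₂} (R : OrderedAbelianGroup c ℓ₁ ℓ₂) (I : RIS.Jobs R)
  (S : Subset (RIS.count I)) (feasible : RIS.Feasible R I S) where

  open OrderedAbelianGroup R
  open OrderedGroupProperties R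
  open RIS R
  open Scheduling R I
  open PosetReasoning poset

  private
    variable
      i : Fin n
      o p q : Maybe (Fin n)

    chain : Chain S
    chain = feasible⇒chain feasible

  y+[x-y]≈x : ∀ x y → y + (x + - y) ≈ x
  y+[x-y]≈x x y = ≈-trans (+-congˡ (+-comm _ _)) (≈-trans (≈-sym (+-assoc _ _ _))
    (≈-trans (+-congʳ (-‿inverseʳ y)) (+-identityˡ x)))

  admissible-≢ : ∀ e f → Admissible S f e → e ≢ f ⊎ e ≡ nothing
  admissible-≢ nothing  f        _        = inj₂ refl
  admissible-≢ (just e) nothing  _        = inj₁ λ ()
  admissible-≢ (just e) (just f) (e∉ , _) = inj₁ λ { refl → e∉ (x∈p∪q⁺ {p = S} (inj₂ (x∈⁅x⁆ e))) }

  admissible-∉ : ∀ e f → Admissible S f e → e ∉∙ S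
  admissible-∉ e f adm = fits⇒∉ chain e (admissible-≢ e f adm) (admissible-fits chain {f} e adm)

  admissible-∉- : ∀ e f → Admissible S f e → e ∉∙ (S - i)
  admissible-∉- nothing  f adm    = tt
  admissible-∉- (just e) f adm e∈ = admissible-∉ (just e) f adm (x∈p-y⇒x∈p e∈)

  -- `x` is the job added in an optimal recovery from a worst deletion. `y` is the deleted job if it
  -- belonged to `S`, and ∅ if the deletion cost nothing.
  robustValue-shape : ∃[ x ] ∃[ y ] robustValue I S ≈ w I S + (weightOf x + - weightOf y)
  robustValue-shape with robustValue-attained S
  ... | f , V≡ with recovered-attained S f
  ...   | e , adm , r≡ = go f refl
    where
    V≈ : robustValue I S ≈ w I (_∪∙_ I (_∖_ I S f) e)
    V≈ = ≈-reflexive (trans V≡ r≡)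

    w-0 : f ∉∙ S → robustValue I S ≈ w I S + (weightOf e + - 0#)
    w-0 f∉S = begin-equality
      robustValue I S                 ≈⟨ V≈ ⟩
      w I (_∪∙_ I (_∖_ I S f) e)      ≈⟨ w-exchange e f∉S (admissible-∉ e f adm) ⟩
      -- Zeros are inserted so that `y+[x-y]≈x` at `0#` can introduce `- 0#`.
      w I S + weightOf e              ≈⟨ +-congˡ (+-identityˡ _) ⟨
      w I S + (0# + weightOf e)       ≈⟨ +-congˡ (+-congˡ (y+[x-y]≈x (weightOf e) 0#)) ⟨
      w I S + (0# + (0# + (weightOf e + - 0#)))  ≈⟨ +-congˡ (+-identityˡ _) ⟩
      w I S + (0# + (weightOf e + - 0#))         ≈⟨ +-congˡ (+-identityˡ _) ⟩
      w I S + (weightOf e + - 0#)     ∎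

    go : ∀ f′ → f ≡ f′ → ∃[ x ] ∃[ y ] robustValue I S ≈ w I S + (weightOf x + - weightOf y)
    go nothing   refl = e , nothing , w-0 tt
    go (just f′) refl with f′ ∈? S
    ... | no f∉S  = e , nothing , w-0 f∉S
    ... | yes f∈S = e , just f′ , (begin-equality
      robustValue I S                         ≈⟨ V≈ ⟩
      w I S′                                   ≈⟨ y+[x-y]≈x _ wf ⟨
      wf + (w I S′ + - wf)                     ≈⟨ +-assoc _ _ _ ⟨
      wf + w I S′ + - wf                       ≈⟨ +-congʳ (+-comm _ _) ⟩
      w I S′ + wf + - wf                       ≈⟨ +-congʳ (w-exchange-∈ e f∈S (admissible-∉- e f adm)) ⟩
      w I S + weightOf e + - wf               ≈⟨ +-assoc _ _ _ ⟩
      w I S + (weightOf e + - wf)             ∎)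
      where
      wf = weight (job I f′)
      S′ = _∪∙_ I (S - f′) e

  module _ {δ} {e₁ e₂}
    (value  : robustValue I S ≈ w I S + δ)
    (adm₁   : Admissible S nothing e₁)
    (value₁ : recovered I S nothing ≡ w I (_∪∙_ I S e₁))
    (adm₂   : Admissible S e₁ e₂)
    (value₂ : recovered I S e₁ ≡ w I (_∪∙_ I (_∖_ I S e₁) e₂)) where

    open Certificates R I δ e₁ e₂
    open Step
    open Invariant hiding (chain)

    e₁∉S = admissible-∉ e₁ nothing adm₁
    e₂∉S = admissible-∉ e₂ e₁ adm₂

    δ-bound : ∀ f → w I S + δ ≤ recovered I S f
    δ-bound f = begin
      w I S + δ         ≈⟨ value ⟨
      robustValue I S   ≤⟨ robustValue≤recovered S f ⟩
      recovered I S f   ∎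

    recovered-∅ : recovered I S nothing ≈ w I S + weightOf e₁
    recovered-∅ = ≈-trans (≈-reflexive value₁)
                          (w-exchange {nothing} e₁ tt e₁∉S)

    δ≤e₁ : δ ≤ weightOf e₁
    δ≤e₁ = +-cancelˡ-≤ (w I S) (begin
      w I S + δ               ≤⟨ δ-bound nothing ⟩
      recovered I S nothing   ≈⟨ recovered-∅ ⟩
      w I S + weightOf e₁     ∎)

    δ≤e₂ : δ ≤ weightOf e₂
    δ≤e₂ = +-cancelˡ-≤ (w I S) (begin
      w I S + δ                     ≤⟨ δ-bound e₁ ⟩
      recovered I S e₁              ≡⟨ value₂ ⟩
      w I (_∪∙_ I (_∖_ I S e₁) e₂)  ≈⟨ w-exchange e₂ e₁∉S e₂∉S ⟩
      w I S + weightOf e₂           ∎)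

    valid : Valid
    valid = δ≤e₁ , δ≤e₂ , e₁≢e₂
      where
      e₁≢e₂ : e₁ ≢ e₂ ⊎ e₁ ≡ nothing
      e₁≢e₂ with admissible-≢ e₂ e₁ adm₂
      ... | inj₁ e₂≢e₁ = inj₁ (e₂≢e₁ ∘ sym)
      ... | inj₂ e₂≡∅ with ≡-dec Fin._≟_ e₁ nothing
      ...   | yes e₁≡∅ = inj₂ e₁≡∅
      ...   | no e₁≢∅  = inj₁ λ e₁≡e₂ → e₁≢∅ (trans e₁≡e₂ e₂≡∅)

    allowed-S : i ∈ S → Allowed (just i)
    allowed-S i∈S = admissible-fits chain e₁ adm₁ i∈S (λ ())
                  -- `e₂` is only known to fit after the deletion of `e₁`, but `e₁` is not in `S`,
                  -- so no member is exempt.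
                  , admissible-fits chain e₂ adm₂ i∈S (λ i≡e₁ → subst (_∉∙ S) (sym i≡e₁) e₁∉S i∈S)

    ≢∅⊎≡∅ : ∀ (e : Maybe (Fin n)) → e ≢ nothing ⊎ e ≡ nothing
    ≢∅⊎≡∅ nothing  = inj₂ refl
    ≢∅⊎≡∅ (just e) = inj₁ λ ()

    ≤e₁ : ∀ e → Fits S nothing e → weightOf e ≤ weightOf e₁
    ≤e₁ e fits = +-cancelˡ-≤ (w I S) (begin
      w I S + weightOf e     ≈⟨ w-∪∙ e (fits⇒∉ chain e (≢∅⊎≡∅ e) fits) ⟨
      w I (_∪∙_ I S e)       ≤⟨ admissible≤recovered e (fits⇒admissible chain e (≢∅⊎≡∅ e) fits) ⟩
      recovered I S nothing  ≈⟨ recovered-∅ ⟩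
      w I S + weightOf e₁    ∎)

    _∈∙S : Maybe (Fin n) → Set
    a ∈∙S = ∀ {i} → a ≡ just i → i ∈ S

    -- The best replacement of p either lies between the neighbours of p or
    -- can be added to S without deleting p, in which case e₁ is as good.

    step-exists : o ∈∙S → p ∈∙S → q ∈∙S → o ⊲ p → p ⊲ q → Allowed q → ∃[ e ] Step o p q e
    step-exists {p = nothing} o∈ p∈ q∈ o⊲p p⊲q q-allowed = e₁ , record
      { ordered     = p⊲q
      ; allowed     = q-allowed
      ; local       = inj₁ refl
      ; compensated = ≤-trans (≤-reflexive (+-identityˡ δ)) δ≤e₁
      }
    step-exists {o} {just p} {q} o∈ p∈ q∈ o⊲p p⊲q q-allowed with recovered-attained S (just p)
    ... | e , adm , r≡ = choose (left o o∈ o⊲p) (right q q∈ p⊲q)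
      where
      wₚ = weight (job I p)

      compensated′ : wₚ + δ ≤ weightOf e
      compensated′ = +-cancelˡ-≤ (w I S) (begin
        w I S + (wₚ + δ)              ≈⟨ +-congˡ (+-comm wₚ δ) ⟩
        w I S + (δ + wₚ)              ≈⟨ +-assoc _ _ _ ⟨
        w I S + δ + wₚ                ≤⟨ +-monoˡ-≤ wₚ (δ-bound (just p)) ⟩
        recovered I S (just p) + wₚ   ≡⟨ cong (_+ wₚ) r≡ ⟩
        w I (_∪∙_ I (S - p) e) + wₚ   ≈⟨ w-exchange-∈ e (p∈ refl) (admissible-∉- e (just p) adm) ⟩
        w I S + weightOf e            ∎)

      fits : Fits S (just p) e
      fits = admissible-fits chain e adm

      fits-all : just p ~ e → Fits S nothing e
      fits-all p~e {i} i∈S _ with i Fin.≟ p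
      ... | yes refl = p~e
      ... | no i≢p   = fits i∈S (i≢p ∘ just-injective)

      left : ∀ o → o ∈∙S → o ⊲ just p → o ⊲ e ⊎ Fits S nothing e
      left nothing  _  _   = inj₁ tt
      left (just o) o∈ o≺p with fits (o∈ refl) (λ { refl → ≺-irrefl o≺p })
      ... | inj₁ o⊲e = inj₁ o⊲e
      -- A replacement beyond the neighbour `o` also lies before `p`, so it can be added with `p`
      -- still present.
      ... | inj₂ e⊲o = inj₂ (fits-all (inj₂ (⊲-trans e (just p) e⊲o o≺p)))

      right : ∀ q → q ∈∙S → just p ⊲ q → e ⊲ q ⊎ Fits S nothing e
      right nothing  _  _   = inj₁ (⊲-nothing e)
      right (just q) q∈ p≺q with fits (q∈ refl) (λ { refl → ≺-irrefl p≺q })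
      ... | inj₁ q⊲e = inj₂ (fits-all (inj₁ (⊲-trans (just p) e p≺q q⊲e)))
      ... | inj₂ e⊲q = inj₁ e⊲q

      e≢p : e ≢ just p
      e≢p refl = admissible-∉ e (just p) adm (p∈ refl)

      global : Fits S nothing e → ∃[ e ] Step o (just p) q e
      global fits∅ = e₁ , record
        { ordered     = p⊲q
        ; allowed     = q-allowed
        ; local       = inj₁ refl
        ; compensated = ≤-trans compensated′ (≤e₁ e fits∅)
        }

      choose : o ⊲ e ⊎ Fits S nothing e → e ⊲ q ⊎ Fits S nothing e → ∃[ e ] Step o (just p) q e
      choose (inj₂ fits∅) _            = global fits∅
      choose (inj₁ _)     (inj₂ fits∅) = global fits∅
      choose (inj₁ o⊲e)   (inj₁ e⊲q)   = e , record
        { ordered     = p⊲q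
        ; allowed     = q-allowed
        ; local       = inj₂ (e≢p , o⊲e , e⊲q)
        ; compensated = compensated′
        }

    -- Induction by removing the last member. Arbitrary subsets of `S` are allowed, because
    -- `step-exists` asks of `o`, `p`, `q` only that they belong to `S` and be ordered, not that
    -- they be consecutive; hence prefixes need not be defined.
    reach-⊆ : ∀ m T → ∣ T ∣ ℕ.≤ m → T ⊆ S → ∃[ m′ ] ∃[ o ] ∃[ p ] m′ ℕ.≤ m × Reach m′ o p T
    reach-⊆ m T ∣T∣≤m T⊆S with nonempty? T
    ... | no ∅ rewrite Empty-unique ∅ = 0 , nothing , nothing , z≤n , base
    reach-⊆ m T ∣T∣≤m T⊆S | yes ne with greatest (λ i∈T j∈T → chain (T⊆S i∈T) (T⊆S j∈T)) ne
    reach-⊆ zero T ∣T∣≤m T⊆S | yes ne | q , q∈T , _ =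
      contradiction (ℕ.<-≤-trans (x∈p⇒∣p-x∣<∣p∣ q∈T) ∣T∣≤m) λ ()
    reach-⊆ (suc m) T ∣T∣≤m T⊆S | yes ne | q , q∈T , ≺q
      with reach-⊆ m (T - q) (ℕ.≤-pred (ℕ.<-≤-trans (x∈p⇒∣p-x∣<∣p∣ q∈T) ∣T∣≤m)) (T⊆S ∘ x∈p-y⇒x∈p)
    ... | m′ , o , p , m′≤m , r =
      suc m′ , p , just q , s≤s m′≤m , subst (Reach _ _ _) ([p-x]∪x≡p q∈T) (step r st)
      where
      inv = invariant r
      p⊲q : ∀ p → (∀ {i} → p ≡ just i → i ∈ T - q) → p ⊲ just q
      p⊲q nothing  _  = tt
      p⊲q (just p) p∈ = ≺q (x∈p-y⇒x∈p (p∈ refl)) (x∈p-y⇒x≢y (p∈ refl))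
      st = proj₂ (step-exists (T⊆S ∘ x∈p-y⇒x∈p ∘ inv .p∈S) (T⊆S ∘ x∈p-y⇒x∈p ∘ inv .q∈S)
             (λ { refl → T⊆S q∈T }) (inv .linked) (p⊲q p (inv .q∈S)) (allowed-S (T⊆S q∈T)))

    certificate : Valid × (∃[ m ] ∃[ o ] ∃[ p ] ∃[ e ] m ℕ.≤ n × Reach m o p S × Step o p nothing e)
    certificate =
      let m , o , p , m≤n , r = reach-⊆ n S (∣p∣≤n S) id
          inv = invariant r
          e , st = step-exists (inv .p∈S) (inv .q∈S) (λ ()) (inv .linked) (⊲-nothing p)
                     (inj₁ tt , inj₁ tt)
      in valid , m , o , p , e , m≤n , r , st

module _ {c ℓ₁ ℓ₂} (R : OrderedAbelianGroup c ℓ₁ ℓ₂) (I : RIS.Jobs R) where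

  open OrderedAbelianGroup R
  open OrderedGroupProperties R
  open RIS R
  open Scheduling R I

  record Certified (S : Subset n) (x y e₁ e₂ : Maybe (Fin n)) : Set (ℓ₁ ⊔ ℓ₂) where
    δ = weightOf x + - weightOf y
    open Certificates R I δ e₁ e₂ public
    field
      value         : robustValue I S ≈ w I S + δ
      valid         : Valid
      {length}      : ℕ
      {o p e}       : Maybe (Fin n)
      length≤n      : length ℕ.≤ n
      reach         : Reach length o p S
      final         : Step o p nothing e

  certified : ∀ S → Feasible I S → ∃[ x ] ∃[ y ] ∃[ e₁ ] ∃[ e₂ ] Certified S x y e₁ e₂
  certified S feasible =
    let x , y , value = robustValue-shape
        e₁ , adm₁ , value₁ = recovered-attained S nothing
        e₂ , adm₂ , value₂ = recovered-attained S e₁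
        valid , m , o , p , e , m≤n , r , st = certificate value adm₁ value₁ adm₂ value₂
    in x , y , e₁ , e₂ , record
         { value = value ; valid = valid ; length≤n = m≤n ; reach = r ; final = st }
    where open Completeness R I S feasible

-- The algorithm

-- Index n stands for ∅ in all arrays indexed by jobs.  SET and VALUE are tables
-- indexed by pairs of such indices; an entry of SET (or BEST) is 0 if absent and
-- otherwise one more than the encoding of a set.

COUNT START END RESULT LO HI ROW CODE SET BEST : ℕ
COUNT  = 0
START  = 1
END    = 2
RESULT = 3
LO     = 4
HI     = 5
ROW    = 6
CODE   = 7
SET    = 8
BEST   = 9

X Y E₁ E₂ ROUND O P Q E J REST : ℕ
X      = 10
Y      = 11
E₁     = 12
E₂     = 13
ROUND  = 14
O      = 15
P      = 16
Q      = 17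
E      = 18
J      = 19
REST   = 20

WEIGHT VALUE BESTVALUE : ℕ
WEIGHT    = 0
VALUE     = 1
BESTVALUE = 2

weightAt : ℕ → WeightExpr
weightAt v = get WEIGHT (var v)

-- Row-major position; `ROW` holds the multiples of n + 1, since the machine cannot multiply.
cellAt : NatExpr → NatExpr → NatExpr
cellAt a b = get ROW a ⊞ b

equals : ℕ → ℕ → Cond
equals u v = test (var u ≤ᴺ var v) and test (var v ≤ᴺ var u)

precedes : ℕ → ℕ → Cond
precedes u v = test (var COUNT ≤ᴺ var u) or test (var COUNT ≤ᴺ var v)
  or test (get HI (var u) ≤ᴺ get LO (var v))

comparable : ℕ → ℕ → Cond
comparable u v = precedes u v or precedes v u

slack : WeightExpr
slack = weightAt X ⊟ weightAt Y

validGuess : Cond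
validGuess = test (slack ≤ᵂ weightAt E₁) and test (slack ≤ᵂ weightAt E₂)
  and (not (equals E₁ E₂) or test (var COUNT ≤ᴺ var E₁))

validStep : Cond
validStep = precedes P Q and (comparable Q E₁ and comparable Q E₂)
  and (equals E E₁ or (not (equals E P) and precedes O E and precedes E Q))
  and test ((weightAt P ⊞ slack) ≤ᵂ weightAt E)

improve : ℕ → ℕ → NatExpr → NatExpr → WeightExpr → Code
improve set value i m v =
  if (test (get set i ≤ᴺ lit 0) or not (test (v ≤ᵂ get value i)))
     -- The weight is stored first: expressions for naturals never read weights, so `i` and `m` keep
     -- their values.
     (setᵂ value i v ⨾ setᴺ set i m)
     skip

-- Job q contributes `place (n ∸ q)`. For ∅, with index n, this is 0, and so is the weight in cell
-- n; the same two expressions thus serve for closing a chain.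
extendedSet : NatExpr
extendedSet = get SET (cellAt (var O) (var P)) ⊞ get CODE (var COUNT ⊟ var Q)

extendedValue : WeightExpr
extendedValue = get VALUE (cellAt (var O) (var P)) ⊞ weightAt Q

relax : Code
relax =
  if (test (lit 1 ≤ᴺ get SET (cellAt (var O) (var P))) and validStep)
     (if (test (var COUNT ≤ᴺ var Q))
         (improve BEST BESTVALUE (lit 0) extendedSet extendedValue)
         (improve SET VALUE (cellAt (var P) (var Q)) extendedSet extendedValue))
     skip

sweep : Code
sweep = loop O (loop P (loop Q (loop E relax)))

clear : Code
clear = setᴺ SET (cellAt (var P) (var Q)) (lit 0)

reset : Code
reset = loop P (loop Q clear)

-- Starting from `slack` instead of 0 makes every entry a bound w S + δ, so that `BESTVALUE` can be
-- compared across guesses.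
origin : Code
origin = setᵂ VALUE (cellAt (var COUNT) (var COUNT)) slack
       ⨾ setᴺ SET (cellAt (var COUNT) (var COUNT)) (lit 1)

tryGuess : Code
tryGuess = if validGuess (reset ⨾ origin ⨾ loop ROUND sweep) skip

-- Together with the rounds and the four loops of `sweep` these are nine nested loops, so the time
-- polynomial has degree nine.
search : Code
search = loop X (loop Y (loop E₁ (loop E₂ tryGuess)))

loadInterval : Code
loadInterval =
  if (test (get END (var J) ≤ᴺ get START (var J)))
     (setᴺ LO (var J) (var J) ⨾ setᴺ HI (var J) (lit 1 ⊞ var J))
     (setᴺ LO (var J) (var COUNT ⊞ get START (var J)) ⨾ setᴺ HI (var J) (var COUNT ⊞ get END (var J)))

extendTables : Code
extendTables = setᴺ ROW (lit 1 ⊞ var J) (lit 1 ⊞ var COUNT ⊞ get ROW (var J))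
             ⨾ setᴺ CODE (lit 1 ⊞ var J) (lit 1 ⊞ get CODE (var J) ⊞ get CODE (var J))

initialise : Code
initialise = loop J (loadInterval ⨾ extendTables)

decodeBit : Code
decodeBit =
  if (test (get CODE (var COUNT ⊟ var J) ≤ᴺ var REST))
     (setᴺ RESULT (var J) (lit 1) ⨾ setᴺ REST (lit 0) (var REST ⊟ get CODE (var COUNT ⊟ var J)))
     (setᴺ RESULT (var J) (lit 0))

output : Code
output = setᴺ REST (lit 0) (get BEST (lit 0) ⊟ lit 1) ⨾ loop J decodeBit

algorithm : Code
algorithm = initialise ⨾ search ⨾ output

-- Encoding of sets by naturals

-- This is 2^i - 1. Compared with 2^i it has the advantage of vanishing at 0, the place of ∅, and a
-- place still exceeds the sum of all lower ones.
place : ℕ → ℕ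
place zero    = 0
place (suc i) = suc (place i ℕ.+ place i)

open SubsetSum ℕ.+-0-commutativeMonoid using () renaming (∑∈ to ∑ᴺ; ∑∈-⊥ to ∑ᴺ-⊥; ∑∈-insert to ∑ᴺ-insert)

encoding : ∀ {n} → Subset n → ℕ
encoding {n} S = ∑ᴺ S λ i → place (n ℕ.∸ toℕ i)

encoding-⊥ : ∀ n → encoding (⊥ {n}) ≡ 0
encoding-⊥ n = ∑ᴺ-⊥ {n} λ i → place (n ℕ.∸ toℕ i)

encoding-insert : ∀ {n} {S : Subset n} {x} → x ∉ S →
  encoding (S ∪ ⁅ x ⁆) ≡ encoding S ℕ.+ place (n ℕ.∸ toℕ x)
encoding-insert {n} x∉S = ∑ᴺ-insert (λ i → place (n ℕ.∸ toℕ i)) x∉S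

-- place is superincreasing, so an encoding is decoded greedily.

encoding-< : ∀ {n} (S : Subset n) → encoding S ℕ.< place (suc n)
encoding-< []                = s≤s z≤n
encoding-< {suc n} (inside  ∷ S) = s≤s (ℕ.+-monoʳ-≤ (place (suc n)) (ℕ.<⇒≤ (encoding-< S)))
encoding-< {suc n} (outside ∷ S) = s≤s (ℕ.≤-trans (ℕ.<⇒≤ (encoding-< S)) (ℕ.m≤m+n _ _))

-- The remainder of greedy decoding after `i` entries. Places are counted from the end of the
-- vector, so this is just the encoding of the remaining vector.
suffix : ∀ {n} → Subset n → ℕ → ℕ
suffix S       zero    = encoding S
suffix []      (suc i) = 0
suffix (_ ∷ S) (suc i) = suffix S i

suffix-step : ∀ {n} (S : Subset n) (i : Fin n) →
              suffix S (toℕ i) ≡ (if lookup S i then place (n ℕ.∸ toℕ i) else 0) ℕ.+ suffix S (suc (toℕ i))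
suffix-step (_ ∷ S) zero    = refl
suffix-step (_ ∷ S) (suc i) = suffix-step S i

suffix-< : ∀ {n} (S : Subset n) (i : Fin n) → suffix S (suc (toℕ i)) ℕ.< place (n ℕ.∸ toℕ i)
suffix-< (_ ∷ S) zero    = encoding-< S
suffix-< (_ ∷ S) (suc i) = suffix-< S i

-- Representation of jobs and conditions in memory

module Memory {c ℓ₁ ℓ₂} (R : OrderedAbelianGroup c ℓ₁ ℓ₂) (I : RIS.Jobs R) where

  open OrderedAbelianGroup R
  open OrderedGroupProperties R
  open Semantics R
  open Execution R
  open RIS R
  open Scheduling R I

  index : Maybe (Fin n) → ℕ
  index nothing  = n
  index (just i) = toℕ i

  index≤n : ∀ a → index a ℕ.≤ n
  index≤n nothing  = ℕ.≤-refl
  index≤n (just i) = ℕ.<⇒≤ (Fin.toℕ<n i)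

  index-injective : ∀ {a b} → index a ≡ index b → a ≡ b
  index-injective {nothing} {nothing} _  = refl
  index-injective {nothing} {just j}  eq = contradiction (sym eq) (ℕ.<⇒≢ (Fin.toℕ<n j))
  index-injective {just i}  {nothing} eq = contradiction eq (ℕ.<⇒≢ (Fin.toℕ<n i))
  index-injective {just i}  {just j}  eq = cong just (Fin.toℕ-injective eq)

  index-surjective : ∀ {i} → i ℕ.≤ n → ∃[ a ] i ≡ index a
  index-surjective i≤n with ℕ.m≤n⇒m<n∨m≡n i≤n
  ... | inj₁ i<n  = just (fromℕ< i<n) , sym (Fin.toℕ-fromℕ< i<n)
  ... | inj₂ refl = nothing , refl

  cell : Maybe (Fin n) → Maybe (Fin n) → ℕ
  cell a b = index a ℕ.* suc n ℕ.+ index b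

  -- A column index is at most `n`, so it is recovered as the remainder modulo n + 1.
  cell-injective : ∀ {a b a′ b′} → cell a b ≡ cell a′ b′ → a ≡ a′ × b ≡ b′
  cell-injective {a} {b} {a′} {b′} eq = a≡a′ , b≡b′
    where
    open ≡.≡-Reasoning
    remainder : ∀ a b → cell a b % suc n ≡ index b
    remainder a b = begin
      (index a ℕ.* suc n ℕ.+ index b) % suc n ≡⟨ cong (_% suc n) (ℕ.+-comm (index a ℕ.* suc n) (index b)) ⟩
      (index b ℕ.+ index a ℕ.* suc n) % suc n ≡⟨ [m+kn]%n≡m%n (index b) (index a) (suc n) ⟩
      index b % suc n                         ≡⟨ m<n⇒m%n≡m (s≤s (index≤n b)) ⟩
      index b                                 ∎
    b≡b′ : b ≡ b′
    b≡b′ = index-injective (trans (sym (remainder a b)) (trans (cong (_% suc n) eq) (remainder a′ b′)))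
    a≡a′ : a ≡ a′
    a≡a′ = index-injective (ℕ.*-cancelʳ-≡ _ _ (suc n) (ℕ.+-cancelʳ-≡ (index b) _ _
      (trans eq (cong (λ b → index a′ ℕ.* suc n ℕ.+ index b) (sym b≡b′)))))

  record Tables (count′ : ℕ) (lo′ hi′ row code : ℕ → ℕ) (weight′ : ℕ → Carrier) : Set c where
    field
      countOk  : count′ ≡ n
      loOk     : ∀ i → lo′ (toℕ i) ≡ lo i
      hiOk     : ∀ i → hi′ (toℕ i) ≡ hi i
      rowOk    : ∀ i → i ℕ.≤ n → row i ≡ i ℕ.* suc n
      codeOk   : ∀ i → i ℕ.≤ n → code i ≡ place i
      weightOk : ∀ a → weight′ (index a) ≡ weightOf a

  -- The arguments of Tables reduce to those of the previous state after a
  -- write to any other array, so that Initialised s is preserved definitionally.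

  Initialised : State → Set c
  Initialised s = Tables (nats s COUNT 0) (nats s LO) (nats s HI) (nats s ROW) (nats s CODE) (weights s WEIGHT)

  record Holds (i : ℕ) (a : Maybe (Fin n)) : Set where
    constructor holding
    field
      index≡ : i ≡ index a

  open Holds

  infix 4 _⊨_≔_

  _⊨_≔_ : State → ℕ → Maybe (Fin n) → Set
  s ⊨ v ≔ a = Holds (nats s v 0) a

  module _ {s} (T : Initialised s) where

    open Tables T

    cell-eval : ∀ {u v a b} → s ⊨ u ≔ a → s ⊨ v ≔ b →
                evalᴺ (cellAt (var u) (var v)) s ≡ cell a b
    cell-eval {a = a} (holding u≔a) (holding v≔b) = cong₂ ℕ._+_ (trans (cong (nats s ROW) u≔a) (rowOk (index a) (index≤n a))) v≔b

    weight-eval : ∀ {v a} → s ⊨ v ≔ a → evalᵂ (weightAt v) s ≡ weightOf a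
    weight-eval {a = a} (holding v≔a) = trans (cong (weights s WEIGHT) v≔a) (weightOk a)

    equals⇒ : ∀ {u v a b} → s ⊨ u ≔ a → s ⊨ v ≔ b → holds (equals u v) s → a ≡ b
    equals⇒ (holding u≔a) (holding v≔b) (lift u≤v , lift v≤u) =
      index-injective (trans (sym u≔a) (trans (ℕ.≤-antisym u≤v v≤u) v≔b))

    ⇒equals : ∀ {u v a b} → s ⊨ u ≔ a → s ⊨ v ≔ b → a ≡ b → holds (equals u v) s
    ⇒equals (holding u≔a) (holding v≔b) refl = lift (ℕ.≤-reflexive eq) , lift (ℕ.≤-reflexive (sym eq))
      where eq = trans u≔a (sym v≔b)

    ∅⇒ : ∀ {v a} → s ⊨ v ≔ a → holds (test (var COUNT ≤ᴺ var v)) s → a ≡ nothing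
    ∅⇒ {a = nothing} v≔a _          = refl
    ∅⇒ {a = just i}  (holding v≔a) (lift n≤v) =
      contradiction (subst₂ ℕ._≤_ countOk v≔a n≤v) (ℕ.<⇒≱ (Fin.toℕ<n i))

    ⇒∅ : ∀ {v a} → s ⊨ v ≔ a → a ≡ nothing → holds (test (var COUNT ≤ᴺ var v)) s
    ⇒∅ (holding v≔a) refl = lift (ℕ.≤-reflexive (trans countOk (sym v≔a)))

    precedes⇒ : ∀ {u v a b} → s ⊨ u ≔ a → s ⊨ v ≔ b → holds (precedes u v) s → a ⊲ b
    precedes⇒ {a = nothing}              _   _   _  = tt
    precedes⇒ {a = just i} {b = nothing} _   _   _  = tt
    precedes⇒ {u} {v} {just i} {just j}  u≔a v≔b (inj₁ h) with () ← ∅⇒ {u} u≔a h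
    precedes⇒ {u} {v} {just i} {just j}  u≔a v≔b (inj₂ (inj₁ h)) with () ← ∅⇒ {v} v≔b h
    precedes⇒ {a = just i} {b = just j}  (holding u≔a) (holding v≔b) (inj₂ (inj₂ (lift h))) =
      subst₂ ℕ._≤_ (trans (cong (nats s HI) u≔a) (hiOk i)) (trans (cong (nats s LO) v≔b) (loOk j)) h

    ⇒precedes : ∀ {u v} a b → s ⊨ u ≔ a → s ⊨ v ≔ b → a ⊲ b → holds (precedes u v) s
    ⇒precedes nothing  b        u≔a v≔b _   = inj₁ (⇒∅ u≔a refl)
    ⇒precedes (just i) nothing  u≔a v≔b _   = inj₂ (inj₁ (⇒∅ v≔b refl))
    ⇒precedes (just i) (just j) (holding u≔a) (holding v≔b) i≺j = inj₂ (inj₂ (lift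
      (subst₂ ℕ._≤_ (sym (trans (cong (nats s HI) u≔a) (hiOk i))) (sym (trans (cong (nats s LO) v≔b) (loOk j))) i≺j)))

    comparable⇒ : ∀ {u v a b} → s ⊨ u ≔ a → s ⊨ v ≔ b → holds (comparable u v) s → a ~ b
    comparable⇒ u≔a v≔b (inj₁ h) = inj₁ (precedes⇒ u≔a v≔b h)
    comparable⇒ u≔a v≔b (inj₂ h) = inj₂ (precedes⇒ v≔b u≔a h)

    ⇒comparable : ∀ {u v} a b → s ⊨ u ≔ a → s ⊨ v ≔ b → a ~ b → holds (comparable u v) s
    ⇒comparable a b u≔a v≔b (inj₁ h) = inj₁ (⇒precedes a b u≔a v≔b h)
    ⇒comparable a b u≔a v≔b (inj₂ h) = inj₂ (⇒precedes b a v≔b u≔a h)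

    module _ {x y e₁ e₂} (X≔ : s ⊨ X ≔ x) (Y≔ : s ⊨ Y ≔ y) (E₁≔ : s ⊨ E₁ ≔ e₁) (E₂≔ : s ⊨ E₂ ≔ e₂) where

      open Certificates R I (weightOf x + - weightOf y) e₁ e₂
      open Step

      slack-eval : evalᵂ slack s ≡ weightOf x + - weightOf y
      slack-eval = cong₂ (λ p q → p + - q) (weight-eval X≔) (weight-eval Y≔)

      validGuess⇒ : holds validGuess s → Valid
      validGuess⇒ (h₁ , h₂ , h₃) = subst₂ _≤_ slack-eval (weight-eval E₁≔) h₁
                                 , subst₂ _≤_ slack-eval (weight-eval E₂≔) h₂
                                 , distinct h₃
        where
        distinct : _ → _
        distinct (inj₁ h) = inj₁ (h ∘ ⇒equals E₁≔ E₂≔)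
        distinct (inj₂ h) = inj₂ (∅⇒ E₁≔ h)

      ⇒validGuess : Valid → holds validGuess s
      ⇒validGuess (h₁ , h₂ , h₃) = subst₂ _≤_ (sym slack-eval) (sym (weight-eval E₁≔)) h₁
                                 , subst₂ _≤_ (sym slack-eval) (sym (weight-eval E₂≔)) h₂
                                 , distinct h₃
        where
        distinct : _ → _
        distinct (inj₁ h) = inj₁ (h ∘ equals⇒ E₁≔ E₂≔)
        distinct (inj₂ h) = inj₂ (⇒∅ E₁≔ h)

      module _ {o p q e} (O≔ : s ⊨ O ≔ o) (P≔ : s ⊨ P ≔ p) (Q≔ : s ⊨ Q ≔ q) (E≔ : s ⊨ E ≔ e) where

        private
          wp-eval : evalᵂ (weightAt P ⊞ slack) s ≡ weightOf p + (weightOf x + - weightOf y)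
          wp-eval = cong₂ _+_ (weight-eval P≔) slack-eval

        validStep⇒ : holds validStep s → Step o p q e
        validStep⇒ (pq , (qe₁ , qe₂) , loc , w≤) = record
          { ordered     = precedes⇒ P≔ Q≔ pq
          ; allowed     = comparable⇒ Q≔ E₁≔ qe₁ , comparable⇒ Q≔ E₂≔ qe₂
          ; local       = [ (λ h → inj₁ (equals⇒ E≔ E₁≔ h))
                          , (λ (e≢p , oe , eq) → inj₂ (e≢p ∘ ⇒equals E≔ P≔ , precedes⇒ O≔ E≔ oe , precedes⇒ E≔ Q≔ eq)) ]′ loc
          ; compensated = subst₂ _≤_ wp-eval (weight-eval E≔) w≤
          }

        ⇒validStep : Step o p q e → holds validStep s
        ⇒validStep st = ⇒precedes p q P≔ Q≔ (st .ordered)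
          , (⇒comparable q e₁ Q≔ E₁≔ (proj₁ (st .allowed)) , ⇒comparable q e₂ Q≔ E₂≔ (proj₂ (st .allowed)))
          , [ (λ h → inj₁ (⇒equals E≔ E₁≔ h))
            , (λ (e≢p , oe , eq) → inj₂ (e≢p ∘ equals⇒ E≔ P≔ , ⇒precedes o e O≔ E≔ oe , ⇒precedes e q E≔ Q≔ eq)) ]′ (st .local)
          , subst₂ _≤_ (sym wp-eval) (sym (weight-eval E≔)) (st .compensated)

-- Improvement of a single entry

module Improving {c ℓ₁ ℓ₂} (R : OrderedAbelianGroup c ℓ₁ ℓ₂) where

  open OrderedAbelianGroup R
  open OrderedGroupProperties R
  open Semantics R
  open Execution R

  evalᴺ-weights : ∀ e {N W W′} → evalᴺ e ⟨ N , W ⟩ ≡ evalᴺ e ⟨ N , W′ ⟩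
  evalᴺ-weights (lit m)           = refl
  evalᴺ-weights (get k e) {N}     = cong (N k) (evalᴺ-weights e)
  evalᴺ-weights (e ⊞ e′)          = cong₂ ℕ._+_ (evalᴺ-weights e) (evalᴺ-weights e′)
  evalᴺ-weights (e ⊟ e′)          = cong₂ ℕ._∸_ (evalᴺ-weights e) (evalᴺ-weights e′)

  Dominates : ℕ → ℕ → State → ℕ → Carrier → Set ℓ₂
  Dominates set value s i u = 1 ℕ.≤ nats s set i × u ≤ weights s value i

  -- `shape` shows that other arrays are untouched, `entry` serves the soundness of stored sets,
  -- `dominates` and `monotone` serve the lower bounds on stored values.
  record Improvement (set value i m : ℕ) (v : Carrier) (s s′ : State) : Set (c ⊔ ℓ₂) where
    field
      shape     : s′ ≡ s ⊎ s′ ≡ ⟨ write (nats s) set i m , write (weights s) value i v ⟩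
      entry     : ∀ j → (nats s′ set j ≡ nats s set j × weights s′ value j ≡ weights s value j)
                      ⊎ (j ≡ i × nats s′ set j ≡ m × weights s′ value j ≡ v)
      dominates : Dominates set value s′ i v
      monotone  : ∀ {j u} → Dominates set value s j u → Dominates set value s′ j u

  improve-spec : ∀ set value i m v {s s′} → improve set value i m v ⊢ s ↦ s′ → 1 ℕ.≤ evalᴺ m s →
                 Improvement set value (evalᴺ i s) (evalᴺ m s) (evalᵂ v s) s s′
  improve-spec set value i m v {s} r 1≤m with if-inv r
  ... | inj₂ (¬h , run) = record
      { shape     = inj₁ refl
      ; entry     = λ _ → inj₁ (refl , refl)
      ; dominates = ℕ.≰⇒> (¬h ∘ inj₁ ∘ lift) , decidable-stable (_ ≤? _) (¬h ∘ inj₂)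
      ; monotone  = id
      }
  ... | inj₁ (h , run) = subst (Improvement set value i′ m′ v′ s) (sym s′≡) record
      { shape     = inj₂ refl
      ; entry     = entry′
      ; dominates = hit
      ; monotone  = monotone′
      }
    where
    i′ = evalᴺ i s
    m′ = evalᴺ m s
    v′ = evalᵂ v s
    s′ = ⟨ write (nats s) set i′ m′ , write (weights s) value i′ v′ ⟩

    s′≡ : exec (setᵂ value i v ⨾ setᴺ set i m) s ≡ s′
    s′≡ = cong₂ (λ i m → ⟨ write (nats s) set i m , weights s′ ⟩) (evalᴺ-weights i) (evalᴺ-weights m)

    hit : Dominates set value s′ i′ v′
    hit = subst (1 ℕ.≤_) (sym (write-hit (nats s) set i′ m′)) 1≤m
        , ≤-reflexive (≈-reflexive (sym (write-hit (weights s) value i′ v′)))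

    kept : ∀ {j} → j ≢ i′ → nats s′ set j ≡ nats s set j × weights s′ value j ≡ weights s value j
    kept j≢i = write-miss (nats s) set i′ m′ (j≢i ∘ sym ∘ proj₂)
             , write-miss (weights s) value i′ v′ (j≢i ∘ sym ∘ proj₂)

    entry′ : ∀ j → (nats s′ set j ≡ nats s set j × weights s′ value j ≡ weights s value j)
                 ⊎ (j ≡ i′ × nats s′ set j ≡ m′ × weights s′ value j ≡ v′)
    entry′ j with j ℕ.≟ i′
    ... | no j≢i   = inj₁ (kept j≢i)
    ... | yes refl = inj₂ (refl , write-hit (nats s) set i′ m′ , write-hit (weights s) value i′ v′)

    monotone′ : ∀ {j u} → Dominates set value s j u → Dominates set value s′ j u
    monotone′ {j} (1≤ , u≤) with j ℕ.≟ i′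
    ... | no j≢i   = subst (1 ℕ.≤_) (sym (proj₁ (kept j≢i))) 1≤
                   , ≤-trans u≤ (≤-reflexive (≈-reflexive (sym (proj₂ (kept j≢i)))))
    ... | yes refl = proj₁ hit , ≤-trans u≤ (≤-trans old≤v (proj₂ hit))
      where
      old≤v : weights s value i′ ≤ v′
      old≤v with ≤-total (weights s value i′) v′
      ... | inj₁ old≤v = old≤v
      ... | inj₂ v≤old = [ (λ (lift ≤0) → contradiction ≤0 (ℕ.<⇒≱ 1≤)) , contradiction v≤old ]′ h

-- Relaxation for a fixed guess

module Searching {c ℓ₁ ℓ₂} (R : OrderedAbelianGroup c ℓ₁ ℓ₂) (I : RIS.Jobs R) where

  open OrderedAbelianGroup R
  open OrderedGroupProperties R
  open Semantics R
  open Execution R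
  open RIS R
  open Scheduling R I
  open Memory R I
  open Improving R
  open CommutativeSemigroupProperties commutativeSemigroup using (xy∙z≈xz∙y)

  module _ {ℓ ℓ′ ℓ″} v b {_⊑_ : State → State → Set ℓ}
           (⊑-refl : ∀ {s} → s ⊑ s) (⊑-trans : ∀ {s s′ s″} → s ⊑ s′ → s′ ⊑ s″ → s ⊑ s″)
           (Pre : State → Set ℓ′) (F : Maybe (Fin n) → State → Set ℓ″)
           (F-mono : ∀ {a s s′} → s ⊑ s′ → F a s → F a s′)
           (stable : ∀ x {s} → Pre s → Pre (assign v x s) × s ⊑ assign v x s)
           (body : ∀ a {s s′} → b ⊢ s ↦ s′ → s ⊨ v ≔ a → Pre s → Pre s′ × s ⊑ s′ × F a s′) where

    -- The n + 1 counter values are exactly the indices of I ∪ {∅}, so a loop quantifies over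
    -- `Maybe (Fin n)`.
    loop-jobs : ∀ {s s′} → loop v b ⊢ s ↦ s′ → nats s 0 0 ≡ n → Pre s →
                Pre s′ × s ⊑ s′ × (∀ a → F a s′)
    loop-jobs r 0n pre =
      let pre′ , ⊑′ , f = loop-forall v b {_⊑_} ⊑-refl ⊑-trans Pre (λ i s → ∀ a → i ≡ index a → F a s)
            (λ ⊑′ f a eq → F-mono ⊑′ (f a eq)) n stable
            (λ i {_} {s′} i≤n vi r pre →
              let a , i≡ = index-surjective i≤n
                  pre′ , ⊑′ , f = body a r (holding (trans vi i≡)) pre
              in pre′ , ⊑′ , λ a′ i≡′ → subst (λ a → F a s′) (index-injective (trans (sym i≡) i≡′)) f)
            r 0n pre
      in pre′ , ⊑′ , λ a → f (index a) (index≤n a) a refl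

  -- Only an inequality, because a guess may underestimate the robust value of the set found with
  -- it.
  BestSound : State → Set ℓ₂
  BestSound s = 1 ℕ.≤ nats s BEST 0 → ∃[ S ] Feasible I S ×
    nats s BEST 0 ≡ suc (encoding S) × weights s BESTVALUE 0 ≤ robustValue I S

  BestDominates : State → Carrier → Set ℓ₂
  BestDominates s = Dominates BEST BESTVALUE s 0

  module Guess (x y e₁ e₂ : Maybe (Fin n)) where

    δ : Carrier
    δ = weightOf x + - weightOf y

    open Certificates R I δ e₁ e₂

    Guessed : State → Set
    Guessed s = s ⊨ X ≔ x × s ⊨ Y ≔ y × s ⊨ E₁ ≔ e₁ × s ⊨ E₂ ≔ e₂

    Genuine : Maybe (Fin n) → Maybe (Fin n) → ℕ → Carrier → Set ℓ₂
    Genuine a b k v = 1 ℕ.≤ k → ∃[ m ] ∃[ S ] Reach m a b S × k ≡ suc (encoding S) × v ≤ w I S + δ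

    TableSound : State → Set ℓ₂
    TableSound s = ∀ a b → Genuine a b (nats s SET (cell a b)) (weights s VALUE (cell a b))

    Context : State → Set (c ⊔ ℓ₂)
    Context s = Initialised s × Guessed s × TableSound s × BestSound s

    CellDominates : State → Maybe (Fin n) → Maybe (Fin n) → Carrier → Set ℓ₂
    CellDominates s a b = Dominates SET VALUE s (cell a b)

    infix 4 _⊑_

    _⊑_ : State → State → Set (c ⊔ ℓ₂)
    s ⊑ s′ = (∀ {i u} → Dominates SET VALUE s i u → Dominates SET VALUE s′ i u)
           × (∀ {u} → BestDominates s u → BestDominates s′ u)

    ⊑-refl : ∀ {s} → s ⊑ s
    ⊑-refl = id , id

    ⊑-trans : ∀ {s s′ s″} → s ⊑ s′ → s′ ⊑ s″ → s ⊑ s″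
    ⊑-trans (f , g) (f′ , g′) = (λ d → f′ (f d)) , (λ d → g′ (g d))

    -- The Bellman-Ford invariant after `r` rounds. It only bounds entries from below, as an entry
    -- may already stem from a longer chain.
    Reachable : ℕ → State → Set ℓ₂
    Reachable r s = ∀ {m a b S} → m ℕ.≤ r → Reach m a b S → CellDominates s a b (w I S + δ)

    Target : Maybe (Fin n) → Maybe (Fin n) → Subset n → State → Set ℓ₂
    Target p (just q) S s = CellDominates s p (just q) (w I (S ∪ ⁅ q ⁆) + δ)
    Target p nothing  S s = BestDominates s (w I S + δ)

    Relaxed : ℕ → (o p q e : Maybe (Fin n)) → State → Set ℓ₂
    Relaxed r o p q e s = ∀ {m S} → m ℕ.≤ r → Reach m o p S → Step o p q e → Target p q S s

    At : (o p q e : Maybe (Fin n)) → State → Set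
    At o p q e s = s ⊨ O ≔ o × s ⊨ P ≔ p × s ⊨ Q ≔ q × s ⊨ E ≔ e

    Outcome : ℕ → (o p q e : Maybe (Fin n)) → State → State → Set (c ⊔ ℓ₂)
    Outcome r o p q e s s′ = (Context s′ × At o p q e s′) × s ⊑ s′ × Relaxed r o p q e s′

    module Relaxation s {o p q} (T : Initialised s) (O≔ : s ⊨ O ≔ o) (P≔ : s ⊨ P ≔ p) (Q≔ : s ⊨ Q ≔ q) where

      open PosetReasoning poset
      open Tables T

      source≡ : evalᴺ (cellAt (var O) (var P)) s ≡ cell o p
      source≡ = cell-eval {s} T {O} {P} O≔ P≔

      value-eval : evalᵂ extendedValue s ≡ weights s VALUE (cell o p) + weightOf q
      value-eval = cong₂ _+_ (cong (weights s VALUE) source≡) (weight-eval {s} T {Q} Q≔)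

      w-∪∙-δ : ∀ {S} → q ∉∙ S → w I S + δ + weightOf q ≈ w I (_∪∙_ I S q) + δ
      w-∪∙-δ q∉S = ≈-trans (xy∙z≈xz∙y _ _ _) (+-congʳ (≈-sym (w-∪∙ q q∉S)))

      value-≥ : ∀ {S} → w I S + δ ≤ weights s VALUE (cell o p) → q ∉∙ S →
        w I (_∪∙_ I S q) + δ ≤ evalᵂ extendedValue s
      value-≥ {S} ≤v q∉S = begin
        w I (_∪∙_ I S q) + δ                      ≈⟨ w-∪∙-δ q∉S ⟨
        w I S + δ + weightOf q                    ≤⟨ +-monoˡ-≤ _ ≤v ⟩
        weights s VALUE (cell o p) + weightOf q   ≡⟨ value-eval ⟨
        evalᵂ extendedValue s                     ∎

      value-≤ : ∀ {S} → weights s VALUE (cell o p) ≤ w I S + δ → q ∉∙ S →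
        evalᵂ extendedValue s ≤ w I (_∪∙_ I S q) + δ
      value-≤ {S} v≤ q∉S = begin
        evalᵂ extendedValue s                     ≡⟨ value-eval ⟩
        weights s VALUE (cell o p) + weightOf q   ≤⟨ +-monoˡ-≤ _ v≤ ⟩
        w I S + δ + weightOf q                    ≈⟨ w-∪∙-δ q∉S ⟩
        w I (_∪∙_ I S q) + δ                      ∎

      encoding-∪∙ : ∀ q {S} → q ∉∙ S → encoding S ℕ.+ place (n ℕ.∸ index q) ≡ encoding (_∪∙_ I S q)
      encoding-∪∙ nothing  {S} _ = trans (cong (λ i → encoding S ℕ.+ place i) (ℕ.n∸n≡0 n)) (ℕ.+-identityʳ _)
      encoding-∪∙ (just q) q∉S = sym (encoding-insert q∉S)

      set-eval : ∀ {S} → nats s SET (cell o p) ≡ suc (encoding S) → q ∉∙ S →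
                 evalᴺ extendedSet s ≡ suc (encoding (_∪∙_ I S q))
      set-eval set≡ q∉S = trans
        (cong₂ ℕ._+_ (trans (cong (nats s SET) source≡) set≡)
          (trans (cong (nats s CODE) (cong₂ ℕ._∸_ countOk (Holds.index≡ Q≔))) (codeOk _ (ℕ.m∸n≤m n (index q)))))
        (cong suc (encoding-∪∙ q q∉S))

    fresh : ∀ {m o p e S} q → Reach m o p S → Step o p q e → q ∉∙ S
    fresh nothing  rc st = tt
    fresh (just q) rc st = reach-∉ rc (Step.ordered st)

    -- `S` is the chain recorded for (o, p) and makes the new entry sound, by `robustValue-bound`;
    -- the last premise makes the entry dominate all chains of at most `r` jobs that end in (o, p).
    best-outcome : ∀ {r o p e s s′ k v m S} → Improvement BEST BESTVALUE 0 k v s s′ → Valid →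
                   Context s → At o p nothing e s → Reach m o p S → Step o p nothing e →
                   k ≡ suc (encoding S) → v ≤ w I S + δ →
                   (∀ {m S} → m ℕ.≤ r → Reach m o p S → w I S + δ ≤ v) →
                   Outcome r o p nothing e s s′
    best-outcome {r} {o} {p} {e} {s} {s′} {k} {v} {m} {S} imp valid (T , g , table , best) at rc st k≡ v≤ ≤v =
      let (T′ , g′ , table′) , at′ , mono = kept shape
      in ((T′ , g′ , table′ , bestSound) , at′) , (mono , monotone)
         , λ m≤r rc _ → proj₁ dominates , ≤-trans (≤v m≤r rc) (proj₂ dominates)
      where
      open Improvement imp

      bestSound : BestSound s′
      bestSound 1≤ with entry 0
      ... | inj₁ (set≡ , value≡) =
        let S , feas , eq , ≤V = best (subst (1 ℕ.≤_) set≡ 1≤)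
        in S , feas , trans set≡ eq , ≤-trans (≤-reflexive (≈-reflexive value≡)) ≤V
      ... | inj₂ (_ , set≡ , value≡) =
        S , chain⇒feasible (Invariant.chain (invariant rc)) , trans set≡ k≡
          , ≤-trans (≤-reflexive (≈-reflexive value≡)) (≤-trans v≤ (robustValue-bound valid (invariant rc) st))

      kept : s′ ≡ s ⊎ s′ ≡ ⟨ write (nats s) BEST 0 k , write (weights s) BESTVALUE 0 v ⟩ →
              (Initialised s′ × Guessed s′ × TableSound s′) × At o p nothing e s′ ×
              (∀ {i u} → Dominates SET VALUE s i u → Dominates SET VALUE s′ i u)
      kept (inj₁ refl) = (T , g , table) , at , id
      kept (inj₂ refl) = (T , g , table) , at , id

    table-outcome : ∀ {r o p q e s s′ k v m S} → Improvement SET VALUE (cell p (just q)) k v s s′ →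
                    Context s → At o p (just q) e s → Reach m o p S → Step o p (just q) e →
                    k ≡ suc (encoding (S ∪ ⁅ q ⁆)) → v ≤ w I (S ∪ ⁅ q ⁆) + δ →
                    (∀ {m S} → m ℕ.≤ r → Reach m o p S → w I (S ∪ ⁅ q ⁆) + δ ≤ v) →
                    Outcome r o p (just q) e s s′
    table-outcome {r} {o} {p} {q} {e} {s} {s′} {k} {v} {m} {S} imp (T , g , table , best) at rc st k≡ v≤ ≤v =
      let (T′ , g′ , best′) , at′ , mono = kept shape
      in ((T′ , g′ , tableSound , best′) , at′) , (monotone , mono)
         , λ m≤r rc _ → proj₁ dominates , ≤-trans (≤v m≤r rc) (proj₂ dominates)
      where
      open Improvement imp

      tableSound : TableSound s′
      tableSound a b 1≤ with entry (cell a b)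
      ... | inj₁ (set≡ , value≡) =
        let m , S , rc , eq , ≤V = table a b (subst (1 ℕ.≤_) set≡ 1≤)
        in m , S , rc , trans set≡ eq , ≤-trans (≤-reflexive (≈-reflexive value≡)) ≤V
      ... | inj₂ (cell≡ , set≡ , value≡) with cell-injective {a} {b} {p} {just q} cell≡
      ...   | refl , refl =
        suc m , S ∪ ⁅ q ⁆ , step rc st , trans set≡ k≡ , ≤-trans (≤-reflexive (≈-reflexive value≡)) v≤

      kept : s′ ≡ s ⊎ s′ ≡ ⟨ write (nats s) SET (cell p (just q)) k , write (weights s) VALUE (cell p (just q)) v ⟩ →
              (Initialised s′ × Guessed s′ × BestSound s′) × At o p (just q) e s′ ×
              (∀ {u} → BestDominates s u → BestDominates s′ u)
      kept (inj₁ refl) = (T , g , best) , at , id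
      kept (inj₂ refl) = (T , g , best) , at , id

    -- If the guard fails, there is nothing to dominate: a chain ending in (o, p) would make the
    -- entry present, and a step would satisfy `validStep`. If it holds, `TableSound` extracts the
    -- recorded chain, which the step extends.
    relax-spec : ∀ {r o p e} q {s s′} → relax ⊢ s ↦ s′ → Valid →
                 Context s → At o p q e s → Reachable r s → Outcome r o p q e s s′
    relax-spec {r} {o} {p} {e} q {s} {s′} rel valid cx@(T , (X≔ , Y≔ , E₁≔ , E₂≔) , table , _) at@(O≔ , P≔ , Q≔ , E≔) rb
      with if-inv rel
    ... | inj₂ (¬h , run) = (cx , at) , ⊑-refl {s} , λ m≤r rc st → contradiction
          (lift (subst (λ i → 1 ℕ.≤ nats s SET i) (sym source≡) (proj₁ (rb m≤r rc)))
          , ⇒validStep {s} T X≔ Y≔ E₁≔ E₂≔ O≔ P≔ Q≔ E≔ st) ¬h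
      where open Relaxation s T O≔ P≔ Q≔
    ... | inj₁ ((lift 1≤ , h) , imp) = improved q at st rc
            (set-eval set≡ q∉S) (value-≤ v≤ q∉S) (λ m≤r rc → value-≥ (proj₂ (rb m≤r rc)) (fresh q rc st))
            (if-inv imp)
      where
      open Relaxation s T O≔ P≔ Q≔
      st = validStep⇒ {s} T X≔ Y≔ E₁≔ E₂≔ O≔ P≔ Q≔ E≔ h
      extracted = table o p (subst (λ i → 1 ℕ.≤ nats s SET i) source≡ 1≤)
      m = proj₁ extracted
      S = proj₁ (proj₂ extracted)
      rc = proj₁ (proj₂ (proj₂ extracted))
      set≡ = proj₁ (proj₂ (proj₂ (proj₂ extracted)))
      v≤ = proj₂ (proj₂ (proj₂ (proj₂ extracted)))
      q∉S = fresh q rc st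

      improved : ∀ q → At o p q e s → Step o p q e → Reach m o p S →
        evalᴺ extendedSet s ≡ suc (encoding (_∪∙_ I S q)) → evalᵂ extendedValue s ≤ w I (_∪∙_ I S q) + δ →
        (∀ {m S} → m ℕ.≤ r → Reach m o p S → w I (_∪∙_ I S q) + δ ≤ evalᵂ extendedValue s) →
        (holds (test (var COUNT ≤ᴺ var Q)) s ×
          (improve BEST BESTVALUE (lit 0) extendedSet extendedValue ⊢ s ↦ s′)) ⊎
        (¬ holds (test (var COUNT ≤ᴺ var Q)) s ×
          (improve SET VALUE (cellAt (var P) (var Q)) extendedSet extendedValue ⊢ s ↦ s′)) →
        Outcome r o p q e s s′
      improved nothing at st rc k≡ v≤ ≤v (inj₁ (_ , imp)) =
        best-outcome (improve-spec BEST BESTVALUE (lit 0) extendedSet extendedValue imp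
                  (subst (1 ℕ.≤_) (sym k≡) (s≤s z≤n))) valid cx at rc st k≡ v≤ ≤v
      improved nothing (_ , _ , Q≔ , _) st rc k≡ v≤ ≤v (inj₂ (¬h , _)) = contradiction (⇒∅ {s} T {Q} Q≔ refl) ¬h
      improved (just q) (_ , _ , Q≔ , _) st rc k≡ v≤ ≤v (inj₁ (h , _)) = contradiction (∅⇒ {s} T {Q} Q≔ h) λ ()
      improved (just q) at@(_ , P≔ , Q≔ , _) st rc k≡ v≤ ≤v (inj₂ (_ , imp)) =
        table-outcome (subst (λ i → Improvement SET VALUE i (evalᴺ extendedSet s) (evalᵂ extendedValue s) s s′)
                 (cell-eval {s} T {P} {Q} P≔ Q≔)
                 (improve-spec SET VALUE (cellAt (var P) (var Q)) extendedSet extendedValue imp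
                  (subst (1 ℕ.≤_) (sym k≡) (s≤s z≤n)))) cx at rc st k≡ v≤ ≤v

    Core : ℕ → State → Set (c ⊔ ℓ₂)
    Core r s = Context s × Reachable r s

    Target-mono : ∀ {p S s s′} q → s ⊑ s′ → Target p q S s → Target p q S s′
    Target-mono nothing  (_ , g) = g
    Target-mono (just q) (f , _) = f

    count≡n : ∀ {r} s → Core r s → nats s 0 0 ≡ n
    count≡n s ((T , _) , _) = Tables.countOk T

    module Sweep (valid : Valid) {r : ℕ} where

      mono : ∀ {o p q e s s′} → s ⊑ s′ → Relaxed r o p q e s → Relaxed r o p q e s′
      mono {q = q} {s = s} {s′} ⊑′ f m≤r rc st = Target-mono {s = s} {s′} q ⊑′ (f m≤r rc st)

      onRelax : ∀ {o p q} e {s s′} → relax ⊢ s ↦ s′ → s ⊨ E ≔ e →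
                Core r s × s ⊨ O ≔ o × s ⊨ P ≔ p × s ⊨ Q ≔ q →
                (Core r s′ × s′ ⊨ O ≔ o × s′ ⊨ P ≔ p × s′ ⊨ Q ≔ q) × s ⊑ s′ × Relaxed r o p q e s′
      onRelax {q = q} e rel E≔ ((cx , rb) , O≔ , P≔ , Q≔) =
        let (cx′ , O≔′ , P≔′ , Q≔′ , _) , ⊑′ , relaxed = relax-spec q rel valid cx (O≔ , P≔ , Q≔ , E≔) rb
        in ((cx′ , λ m≤r rc → proj₁ ⊑′ (rb m≤r rc)) , O≔′ , P≔′ , Q≔′) , ⊑′ , relaxed

      onE : ∀ {o p q s s′} → loop E relax ⊢ s ↦ s′ → Core r s × s ⊨ O ≔ o × s ⊨ P ≔ p × s ⊨ Q ≔ q →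
            (Core r s′ × s′ ⊨ O ≔ o × s′ ⊨ P ≔ p × s′ ⊨ Q ≔ q) × s ⊑ s′ × (∀ e → Relaxed r o p q e s′)
      onE {o} {p} {q} {s} rel pre = loop-jobs E relax {_⊑_}
        (λ {s} → ⊑-refl {s}) (λ {s} {s′} {s″} → ⊑-trans {s} {s′} {s″})
        (λ s → Core r s × s ⊨ O ≔ o × s ⊨ P ≔ p × s ⊨ Q ≔ q) (Relaxed r o p q)
        (λ {e} {s} {s′} → mono {o} {p} {q} {e} {s} {s′})
        (λ x {s} pr → pr , ⊑-refl {s})
        onRelax rel (count≡n s (proj₁ pre)) pre

      onQ : ∀ {o p s s′} → loop Q (loop E relax) ⊢ s ↦ s′ → Core r s × s ⊨ O ≔ o × s ⊨ P ≔ p →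
            (Core r s′ × s′ ⊨ O ≔ o × s′ ⊨ P ≔ p) × s ⊑ s′ × (∀ q e → Relaxed r o p q e s′)
      onQ {o} {p} {s} rel pre = loop-jobs Q (loop E relax) {_⊑_}
        (λ {s} → ⊑-refl {s}) (λ {s} {s′} {s″} → ⊑-trans {s} {s′} {s″})
        (λ s → Core r s × s ⊨ O ≔ o × s ⊨ P ≔ p) (λ q s → ∀ e → Relaxed r o p q e s)
        (λ {q} {s} {s′} ⊑′ f e → mono {o} {p} {q} {e} {s} {s′} ⊑′ (f e))
        (λ x {s} pr → pr , ⊑-refl {s})
        (λ q rel Q≔ (core , O≔ , P≔) → let (core′ , O≔′ , P≔′ , _) , rest = onE rel (core , O≔ , P≔ , Q≔)
                                       in (core′ , O≔′ , P≔′) , rest)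
        rel (count≡n s (proj₁ pre)) pre

      onP : ∀ {o s s′} → loop P (loop Q (loop E relax)) ⊢ s ↦ s′ → Core r s × s ⊨ O ≔ o →
            (Core r s′ × s′ ⊨ O ≔ o) × s ⊑ s′ × (∀ p q e → Relaxed r o p q e s′)
      onP {o} {s} rel pre = loop-jobs P (loop Q (loop E relax)) {_⊑_}
        (λ {s} → ⊑-refl {s}) (λ {s} {s′} {s″} → ⊑-trans {s} {s′} {s″})
        (λ s → Core r s × s ⊨ O ≔ o) (λ p s → ∀ q e → Relaxed r o p q e s)
        (λ {p} {s} {s′} ⊑′ f q e → mono {o} {p} {q} {e} {s} {s′} ⊑′ (f q e))
        (λ x {s} pr → pr , ⊑-refl {s})
        (λ p rel P≔ (core , O≔) → let (core′ , O≔′ , _) , rest = onQ rel (core , O≔ , P≔)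
                                  in (core′ , O≔′) , rest)
        rel (count≡n s (proj₁ pre)) pre

      -- The table is updated in place, so a relaxation may read entries improved in the same sweep.
      -- This does no harm: entries remain genuine and the bounds for `r` persist.
      sweep-spec : ∀ {s s′} → sweep ⊢ s ↦ s′ → Core r s →
                   Core r s′ × s ⊑ s′ × (∀ o p q e → Relaxed r o p q e s′)
      sweep-spec {s} rel pre = loop-jobs O (loop P (loop Q (loop E relax))) {_⊑_}
        (λ {s} → ⊑-refl {s}) (λ {s} {s′} {s″} → ⊑-trans {s} {s′} {s″})
        (Core r) (λ o s → ∀ p q e → Relaxed r o p q e s)
        (λ {o} {s} {s′} ⊑′ f p q e → mono {o} {p} {q} {e} {s} {s′} ⊑′ (f p q e))
        (λ x {s} pr → pr , ⊑-refl {s})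
        (λ o rel O≔ core → let (core′ , _) , rest = onP rel (core , O≔) in core′ , rest)
        rel (count≡n s pre) pre

    BestReached : ℕ → State → Set ℓ₂
    BestReached r s = ∀ {m o p e S} → m ℕ.< r → Reach m o p S → Step o p nothing e → BestDominates s (w I S + δ)

    -- Round `r` closes the chains of at most `r` jobs. A chain has up to `n` jobs, so the rounds 0,
    -- ..., n are needed.
    rounds-spec : ∀ {s s′} → loop ROUND sweep ⊢ s ↦ s′ → Valid → Core 0 s →
                  Context s′ × (∀ {u} → BestDominates s u → BestDominates s′ u) × BestReached (suc n) s′
    rounds-spec {s₀} rel valid core₀ =
      let (cx , _) , mono , reached = loop-invariant ROUND sweep Inv n (λ x pr → pr)
            (λ r _ _ rel pr → round r rel pr) rel (count≡n s₀ core₀) (core₀ , id , λ ())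
      in cx , mono , reached
      where
      Inv : ℕ → State → Set (c ⊔ ℓ₂)
      Inv r s = Core r s × (∀ {u} → BestDominates s₀ u → BestDominates s u) × BestReached r s

      reachable : ∀ {r s} → Reachable r s → (∀ o p q e → Relaxed r o p q e s) → Reachable (suc r) s
      reachable rb relaxed _         base         = rb z≤n base
      reachable rb relaxed (s≤s m≤r) (step rc st) = relaxed _ _ _ _ m≤r rc st

      round : ∀ r {s s′} → sweep ⊢ s ↦ s′ → Inv r s → Inv (suc r) s′
      round r rel (core , mono , _) =
        let (cx′ , rb′) , ⊑′ , relaxed = Sweep.sweep-spec valid rel core
        in (cx′ , reachable rb′ relaxed) , (λ d → proj₂ ⊑′ (mono d))
           , λ m≤r rc st → relaxed _ _ nothing _ (ℕ.≤-pred m≤r) rc st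

-- The search over all guesses

module Guessing {c ℓ₁ ℓ₂} (R : OrderedAbelianGroup c ℓ₁ ℓ₂) (I : RIS.Jobs R) where

  open OrderedAbelianGroup R
  open OrderedGroupProperties R
  open Semantics R
  open Execution R
  open RIS R
  open Scheduling R I
  open Memory R I
  open Improving R
  open Searching R I

  infix 4 _⊑ᴮ_

  _⊑ᴮ_ : State → State → Set (c ⊔ ℓ₂)
  s ⊑ᴮ s′ = ∀ {u} → BestDominates s u → BestDominates s′ u

  ⊑ᴮ-refl : ∀ s → s ⊑ᴮ s
  ⊑ᴮ-refl s d = d

  ⊑ᴮ-trans : ∀ s s′ s″ → s ⊑ᴮ s′ → s′ ⊑ᴮ s″ → s ⊑ᴮ s″
  ⊑ᴮ-trans s s′ s″ f g d = g (f d)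

  module _ {x y e₁ e₂ : Maybe (Fin n)} where

    open Guess x y e₁ e₂
    open Certificates R I (weightOf x + - weightOf y) e₁ e₂

    -- Without `TableSound`, since the table may still contain chains made for another guess.
    Ready : State → Set (c ⊔ ℓ₂)
    Ready s = Initialised s × Guessed s × BestSound s

    Blank : Maybe (Fin n) → Maybe (Fin n) → State → Set
    Blank a b s = nats s SET (cell a b) ≡ 0

    _⊑₀_ : State → State → Set (c ⊔ ℓ₂)
    s ⊑₀ s′ = (∀ {i} → nats s SET i ≡ 0 → nats s′ SET i ≡ 0) × s ⊑ᴮ s′

    ⊑₀-refl : ∀ s → s ⊑₀ s
    ⊑₀-refl s = id , ⊑ᴮ-refl s

    ⊑₀-trans : ∀ s s′ s″ → s ⊑₀ s′ → s′ ⊑₀ s″ → s ⊑₀ s″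
    ⊑₀-trans s s′ s″ (f , f′) (g , g′) = (λ z → g (f z)) , ⊑ᴮ-trans s s′ s″ f′ g′

    clear-spec : ∀ {a} b {s s′} → clear ⊢ s ↦ s′ → s ⊨ Q ≔ b →
                 Ready s × s ⊨ P ≔ a → (Ready s′ × s′ ⊨ P ≔ a) × s ⊑₀ s′ × Blank a b s′
    clear-spec {a} b {s} run Q≔ (ready@(T , _) , P≔) = (ready , P≔) , (still0 , ⊑ᴮ-refl s) , blank
      where
      i = evalᴺ (cellAt (var P) (var Q)) s
      still0 : ∀ {j} → nats s SET j ≡ 0 → write (nats s) SET i 0 SET j ≡ 0
      still0 {j} ≡0 with i ℕ.≟ j
      ... | yes refl = write-hit (nats s) SET i 0
      ... | no i≢j   = trans (write-miss (nats s) SET i 0 (i≢j ∘ proj₂)) ≡0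
      blank : write (nats s) SET i 0 SET (cell a b) ≡ 0
      blank = subst (λ j → write (nats s) SET i 0 SET j ≡ 0) (cell-eval {s} T {P} {Q} P≔ Q≔) (write-hit (nats s) SET i 0)

    reset-spec : ∀ {s s′} → reset ⊢ s ↦ s′ → Ready s → Ready s′ × s ⊑₀ s′ × (∀ a b → Blank a b s′)
    reset-spec {s} rel ready = loop-jobs P (loop Q clear) {_⊑₀_} (λ {s} → ⊑₀-refl s) (λ {s} {s′} {s″} → ⊑₀-trans s s′ s″)
        Ready (λ a s → ∀ b → Blank a b s)
        (λ ⊑′ f b → proj₁ ⊑′ (f b))
        (λ x {s} pr → pr , ⊑₀-refl s)
        (λ a rel P≔ ready → let (ready′ , _) , rest = onQ rel (ready , P≔) in ready′ , rest)
        rel (Tables.countOk (proj₁ ready)) ready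
      where
      onQ : ∀ {a s s′} → loop Q clear ⊢ s ↦ s′ → Ready s × s ⊨ P ≔ a →
            (Ready s′ × s′ ⊨ P ≔ a) × s ⊑₀ s′ × (∀ b → Blank a b s′)
      onQ {a} rel pre = loop-jobs Q clear {_⊑₀_} (λ {s} → ⊑₀-refl s) (λ {s} {s′} {s″} → ⊑₀-trans s s′ s″)
        (λ s → Ready s × s ⊨ P ≔ a) (Blank a)
        (λ ⊑′ f → proj₁ ⊑′ f)
        (λ x {s} pr → pr , ⊑₀-refl s)
        clear-spec rel (Tables.countOk (proj₁ (proj₁ pre))) pre

    w-⊥ : w I ⊥ + δ ≈ δ
    w-⊥ = ≈-trans (+-congʳ (SubsetSum.∑∈-⊥ commutativeMonoid (weight ∘ job I))) (+-identityˡ δ)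

    -- On a blank table the cell of (∅, ∅) becomes the only present entry, and it belongs to `base`,
    -- the only chain of length 0.
    origin-spec : ∀ {s s′} → origin ⊢ s ↦ s′ → Ready s → (∀ a b → Blank a b s) → Core 0 s′ × s ⊑ᴮ s′
    origin-spec {s} run (T , guessed@(X≔ , Y≔ , E₁≔ , E₂≔) , best) blank =
      ((T , guessed , tableSound , best) , reachable) , ⊑ᴮ-refl s
      where
      i = evalᴺ (cellAt (var COUNT) (var COUNT)) s
      v = evalᵂ slack s
      N = write (nats s) SET i 1
      W = write (weights s) VALUE i v

      i≡ : i ≡ cell nothing nothing
      i≡ = cell-eval {s} T {COUNT} {COUNT} {nothing} {nothing} (holding (Tables.countOk T)) (holding (Tables.countOk T))

      v≡ : v ≡ δ
      v≡ = slack-eval {s} T X≔ Y≔ E₁≔ E₂≔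

      tableSound : ∀ a b → Genuine a b (N SET (cell a b)) (W VALUE (cell a b))
      tableSound a b 1≤ with i ℕ.≟ cell a b
      ... | no i≢ = contradiction (subst (1 ℕ.≤_) (trans (write-miss (nats s) SET i 1 (i≢ ∘ proj₂)) (blank a b)) 1≤) λ ()
      ... | yes i≡′ with cell-injective {nothing} {nothing} {a} {b} (trans (sym i≡) i≡′)
      ...   | refl , refl = 0 , ⊥ , base
              , trans (subst (λ j → N SET j ≡ 1) i≡ (write-hit (nats s) SET i 1)) (cong suc (sym (encoding-⊥ n)))
              , ≤-reflexive (≈-trans (≈-reflexive (trans (subst (λ j → W VALUE j ≡ v) i≡ (write-hit (weights s) VALUE i v)) v≡)) (≈-sym w-⊥))

      reachable : ∀ {m a b S} → m ℕ.≤ 0 → Reach m a b S →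
        1 ℕ.≤ N SET (cell a b) × w I S + δ ≤ W VALUE (cell a b)
      reachable z≤n base =
          ℕ.≤-reflexive (sym (subst (λ j → N SET j ≡ 1) i≡ (write-hit (nats s) SET i 1)))
        , ≤-reflexive (≈-trans w-⊥ (≈-reflexive (sym (trans (subst (λ j → W VALUE j ≡ v) i≡ (write-hit (weights s) VALUE i v)) v≡))))

    Found : State → Set (ℓ₁ ⊔ ℓ₂)
    Found s = ∀ {S} → Certified R I S x y e₁ e₂ → BestDominates s (robustValue I S)

    tryGuess-spec : ∀ {s s′} → tryGuess ⊢ s ↦ s′ → Ready s → Ready s′ × s ⊑ᴮ s′ × Found s′
    tryGuess-spec {s} rel ready@(T , (X≔ , Y≔ , E₁≔ , E₂≔) , best) with if-inv rel
    ... | inj₂ (¬h , run) = ready , ⊑ᴮ-refl s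
          , λ cert → contradiction (⇒validGuess {s} T X≔ Y≔ E₁≔ E₂≔ (Certified.valid cert)) ¬h
    ... | inj₁ (h , rel) =
      let s₁ , rel₁ , rel = ⨾-inv rel
          s₂ , rel₂ , rel₃ = ⨾-inv rel
          ready₁ , ⊑₁ , blank = reset-spec rel₁ ready
          core , ⊑₂ = origin-spec rel₂ ready₁ blank
          (T′ , guessed′ , _ , best′) , ⊑₃ , reached = rounds-spec rel₃ (validGuess⇒ {s} T X≔ Y≔ E₁≔ E₂≔ h) core
      in (T′ , guessed′ , best′) , (λ d → ⊑₃ (⊑₂ (proj₂ ⊑₁ d)))
         -- The guess of a certificate is exact: w S + δ equals the robust value by `value`.
         , λ cert → let open Certified cert
                        1≤ , ≤v = reached (s≤s length≤n) reach final
                    in 1≤ , ≤-trans (≤-reflexive value) ≤v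

  Searched : State → Set (c ⊔ ℓ₂)
  Searched s = Initialised s × BestSound s

  search-spec : ∀ {s s′} → search ⊢ s ↦ s′ → Searched s →
                Searched s′ × s ⊑ᴮ s′ × (∀ x y e₁ e₂ → Found {x} {y} {e₁} {e₂} s′)
  search-spec {s} rel pre = loop-jobs X (loop Y (loop E₁ (loop E₂ tryGuess))) {_⊑ᴮ_}
      (λ {s} → ⊑ᴮ-refl s) (λ {s} {s′} {s″} → ⊑ᴮ-trans s s′ s″)
      Searched (λ x s → ∀ y e₁ e₂ → Found {x} {y} {e₁} {e₂} s)
      (λ ⊑′ f y e₁ e₂ cert → ⊑′ (f y e₁ e₂ cert))
      (λ x {s} pr → pr , ⊑ᴮ-refl s)
      (λ x rel X≔ pre → let (pre′ , _) , rest = onY rel (pre , X≔) in pre′ , rest)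
      rel (Tables.countOk (proj₁ pre)) pre
    where
    onE₂ : ∀ {x y e₁ s s′} → loop E₂ tryGuess ⊢ s ↦ s′ →
      Searched s × s ⊨ X ≔ x × s ⊨ Y ≔ y × s ⊨ E₁ ≔ e₁ →
           (Searched s′ × s′ ⊨ X ≔ x × s′ ⊨ Y ≔ y × s′ ⊨ E₁ ≔ e₁) × s ⊑ᴮ s′ × (∀ e₂ → Found {x} {y} {e₁} {e₂} s′)
    onE₂ {x} {y} {e₁} rel pre = loop-jobs E₂ tryGuess {_⊑ᴮ_}
      (λ {s} → ⊑ᴮ-refl s) (λ {s} {s′} {s″} → ⊑ᴮ-trans s s′ s″)
      (λ s → Searched s × s ⊨ X ≔ x × s ⊨ Y ≔ y × s ⊨ E₁ ≔ e₁) (λ e₂ s → Found {x} {y} {e₁} {e₂} s)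
      (λ ⊑′ f cert → ⊑′ (f cert))
      (λ x {s} pr → pr , ⊑ᴮ-refl s)
      (λ e₂ rel E₂≔ ((T , best) , X≔ , Y≔ , E₁≔) →
        let (T′ , (X≔′ , Y≔′ , E₁≔′ , _) , best′) , rest = tryGuess-spec {x} {y} {e₁} {e₂} rel (T , (X≔ , Y≔ , E₁≔ , E₂≔) , best)
        in ((T′ , best′) , X≔′ , Y≔′ , E₁≔′) , rest)
      rel (Tables.countOk (proj₁ (proj₁ pre))) pre

    onE₁ : ∀ {x y s s′} → loop E₁ (loop E₂ tryGuess) ⊢ s ↦ s′ → Searched s × s ⊨ X ≔ x × s ⊨ Y ≔ y →
           (Searched s′ × s′ ⊨ X ≔ x × s′ ⊨ Y ≔ y) × s ⊑ᴮ s′ × (∀ e₁ e₂ → Found {x} {y} {e₁} {e₂} s′)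
    onE₁ {x} {y} rel pre = loop-jobs E₁ (loop E₂ tryGuess) {_⊑ᴮ_}
      (λ {s} → ⊑ᴮ-refl s) (λ {s} {s′} {s″} → ⊑ᴮ-trans s s′ s″)
      (λ s → Searched s × s ⊨ X ≔ x × s ⊨ Y ≔ y) (λ e₁ s → ∀ e₂ → Found {x} {y} {e₁} {e₂} s)
      (λ ⊑′ f e₂ cert → ⊑′ (f e₂ cert))
      (λ x {s} pr → pr , ⊑ᴮ-refl s)
      (λ e₁ rel E₁≔ (pre , X≔ , Y≔) → let (pre′ , X≔′ , Y≔′ , _) , rest = onE₂ rel (pre , X≔ , Y≔ , E₁≔)
                                      in (pre′ , X≔′ , Y≔′) , rest)
      rel (Tables.countOk (proj₁ (proj₁ pre))) pre

    onY : ∀ {x s s′} → loop Y (loop E₁ (loop E₂ tryGuess)) ⊢ s ↦ s′ → Searched s × s ⊨ X ≔ x →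
          (Searched s′ × s′ ⊨ X ≔ x) × s ⊑ᴮ s′ × (∀ y e₁ e₂ → Found {x} {y} {e₁} {e₂} s′)
    onY {x} rel pre = loop-jobs Y (loop E₁ (loop E₂ tryGuess)) {_⊑ᴮ_}
      (λ {s} → ⊑ᴮ-refl s) (λ {s} {s′} {s″} → ⊑ᴮ-trans s s′ s″)
      (λ s → Searched s × s ⊨ X ≔ x) (λ y s → ∀ e₁ e₂ → Found {x} {y} {e₁} {e₂} s)
      (λ ⊑′ f e₁ e₂ cert → ⊑′ (f e₁ e₂ cert))
      (λ x {s} pr → pr , ⊑ᴮ-refl s)
      (λ y rel Y≔ (pre , X≔) → let (pre′ , X≔′ , _) , rest = onE₁ rel (pre , X≔ , Y≔)
                               in (pre′ , X≔′) , rest)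
      rel (Tables.countOk (proj₁ (proj₁ pre))) pre

-- Preprocessing of the input and decoding of the answer

module InputOutput {c ℓ₁ ℓ₂} (R : OrderedAbelianGroup c ℓ₁ ℓ₂) (I : RIS.Jobs R) where

  open OrderedAbelianGroup R
  open OrderedGroupProperties R
  open Semantics R
  open Execution R
  open RIS R
  open Scheduling R I
  open Memory R I

  fill-< : ∀ {a} {A : Set a} {m z} (f : Fin m → A) i → fill z f (toℕ i) ≡ f i
  fill-< {m = m} f i with toℕ i ℕ.<? m
  ... | yes i<m = cong f (Fin.fromℕ<-toℕ i i<m)
  ... | no i≮m  = contradiction (Fin.toℕ<n i) i≮m

  fill-≥ : ∀ {a} {A : Set a} {m z} (f : Fin m → A) → fill z f m ≡ z
  fill-≥ {m = m} f with m ℕ.<? m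
  ... | yes m<m = contradiction m<m (ℕ.n≮n m)
  ... | no _    = refl

  write-extend : ∀ {a ℓ} {A : Set a} (G : ℕ → A → Set ℓ) (M : ℕ → ℕ → A) k i x →
                 (∀ j → j ℕ.< i → G j (M k j)) → G i x → ∀ j → j ℕ.< suc i → G j (write M k i x k j)
  write-extend G M k i x g gi j (s≤s j≤i) with ℕ.m≤n⇒m<n∨m≡n j≤i
  ... | inj₁ j<i  = subst (G j) (sym (write-miss M k i x (λ (_ , i≡j) → ℕ.<⇒≢ j<i (sym i≡j)))) (g j j<i)
  ... | inj₂ refl = subst (G j) (sym (write-hit M k j x)) gi

  lo-empty : ∀ i → end (job I i) ℕ.≤ start (job I i) → lo i ≡ toℕ i × hi i ≡ suc (toℕ i)
  lo-empty i e≤s with empty? i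
  ... | yes _  = refl , refl
  ... | no e≰s = contradiction e≤s e≰s

  lo-nonempty : ∀ i → ¬ end (job I i) ℕ.≤ start (job I i) →
                lo i ≡ n ℕ.+ start (job I i) × hi i ≡ n ℕ.+ end (job I i)
  lo-nonempty i e≰s with empty? i
  ... | yes e≤s = contradiction e≤s e≰s
  ... | no _    = refl , refl

  -- Vacuous for `j = n`, the round of the loop to which no job corresponds.
  LoOk HiOk : ℕ → ℕ → Set
  LoOk j x = ∀ i → toℕ i ≡ j → x ≡ lo i
  HiOk j x = ∀ i → toℕ i ≡ j → x ≡ hi i

  -- Two bounds, because `ROW` and `CODE` are one entry ahead: their entry 0 is correct from the
  -- start, and a round fills in the next one.
  Loaded : ℕ → ℕ → State → Set c
  Loaded k m s = (nats s COUNT 0 ≡ n × nats s BEST 0 ≡ 0)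
    × ((∀ i → nats s START (toℕ i) ≡ start (job I i)) × (∀ i → nats s END (toℕ i) ≡ end (job I i))
       × (∀ a → weights s WEIGHT (index a) ≡ weightOf a))
    × (∀ j → j ℕ.< k → LoOk j (nats s LO j)) × (∀ j → j ℕ.< k → HiOk j (nats s HI j))
    × (∀ j → j ℕ.< m → nats s ROW j ≡ j ℕ.* suc n) × (∀ j → j ℕ.< m → nats s CODE j ≡ place j)

  load-weight : ∀ a → weights (load I) WEIGHT (index a) ≡ weightOf a
  load-weight nothing  = fill-≥ (weight ∘ job I)
  load-weight (just i) = fill-< (weight ∘ job I) i

  load-loaded : Loaded 0 1 (load I)
  load-loaded = (refl , refl)
    , (fill-< (start ∘ job I) , fill-< (end ∘ job I) , load-weight)
    , (λ _ ()) , (λ _ ()) , (λ { zero _ → refl ; (suc _) (s≤s ()) }) , (λ { zero _ → refl ; (suc _) (s≤s ()) })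

  loadInterval-spec : ∀ {s s′} → loadInterval ⊢ s ↦ s′ → Loaded (nats s J 0) (suc (nats s J 0)) s →
                      Loaded (suc (nats s J 0)) (suc (nats s J 0)) s′ × nats s′ J 0 ≡ nats s J 0
  loadInterval-spec {s} rel (counts@(n≡ , _) , input@(start≡ , end≡ , _) , los , his , tables) with if-inv rel
  ... | inj₁ (lift h , run) =
        (counts , input
        , write-extend LoOk (nats s) LO j _ los (λ i i≡j → trans (sym i≡j) (sym (proj₁ (lo-empty i (empty i i≡j)))))
        , write-extend HiOk (nats s) HI j _ his (λ i i≡j → trans (cong suc (sym i≡j)) (sym (proj₂ (lo-empty i (empty i i≡j)))))
        , tables) , refl
    where
    j = nats s J 0
    empty : ∀ i → toℕ i ≡ j → end (job I i) ℕ.≤ start (job I i)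
    empty i i≡j = subst₂ ℕ._≤_ (trans (cong (nats s END) (sym i≡j)) (end≡ i)) (trans (cong (nats s START) (sym i≡j)) (start≡ i)) h
  ... | inj₂ (¬h , run) =
        (counts , input
        , write-extend LoOk (nats s) LO j _ los (λ i i≡j → trans (cong₂ ℕ._+_ n≡ (start≡′ i i≡j)) (sym (proj₁ (lo-nonempty i (nonempty i i≡j)))))
        , write-extend HiOk (nats s) HI j _ his (λ i i≡j → trans (cong₂ ℕ._+_ n≡ (end≡′ i i≡j)) (sym (proj₂ (lo-nonempty i (nonempty i i≡j)))))
        , tables) , refl
    where
    j = nats s J 0
    start≡′ : ∀ i → toℕ i ≡ j → nats s START j ≡ start (job I i)
    start≡′ i i≡j = trans (cong (nats s START) (sym i≡j)) (start≡ i)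
    end≡′ : ∀ i → toℕ i ≡ j → nats s END j ≡ end (job I i)
    end≡′ i i≡j = trans (cong (nats s END) (sym i≡j)) (end≡ i)
    nonempty : ∀ i → toℕ i ≡ j → ¬ end (job I i) ℕ.≤ start (job I i)
    nonempty i i≡j e≤s = ¬h (lift (subst₂ ℕ._≤_ (sym (end≡′ i i≡j)) (sym (start≡′ i i≡j)) e≤s))

  extendTables-spec : ∀ {s s′} → extendTables ⊢ s ↦ s′ →
    Loaded (suc (nats s J 0)) (suc (nats s J 0)) s →
    Loaded (suc (nats s J 0)) (suc (suc (nats s J 0))) s′
  extendTables-spec {s} run (counts@(n≡ , _) , input , los , his , rows , codes) =
    counts , input , los , his
    , write-extend (λ j x → x ≡ j ℕ.* suc n) (nats s) ROW (suc j) _ rows (cong₂ ℕ._+_ (cong suc n≡) (rows j ℕ.≤-refl))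
    , write-extend (λ j x → x ≡ place j) (nats s) CODE (suc j) _ codes (cong (λ x → suc (x ℕ.+ x)) (codes j ℕ.≤-refl))
    where j = nats s J 0

  initialise-spec : ∀ {s} → initialise ⊢ load I ↦ s → Initialised s × nats s BEST 0 ≡ 0
  initialise-spec rel =
    let (n≡ , best) , (_ , _ , weights≡) , los , his , rows , codes =
          loop-invariant J (loadInterval ⨾ extendTables) (λ k → Loaded k (suc k)) n (λ x pr → pr) body rel refl load-loaded
    in record
      { countOk  = n≡
      ; loOk     = λ i → los (toℕ i) (ℕ.m<n⇒m<1+n (Fin.toℕ<n i)) i refl
      ; hiOk     = λ i → his (toℕ i) (ℕ.m<n⇒m<1+n (Fin.toℕ<n i)) i refl
      ; rowOk    = λ i i≤n → rows i (ℕ.m<n⇒m<1+n (s≤s i≤n))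
      ; codeOk   = λ i i≤n → codes i (ℕ.m<n⇒m<1+n (s≤s i≤n))
      ; weightOk = weights≡
      } , best
    where
    body : ∀ i {s s′} → i ℕ.≤ n → nats s J 0 ≡ i → loadInterval ⨾ extendTables ⊢ s ↦ s′ →
      Loaded i (suc i) s → Loaded (suc i) (suc (suc i)) s′
    body _ {s} {s′} _ refl rel loading =
      let s₁ , rel₁ , rel₂ = ⨾-inv rel
          half , j≡ = loadInterval-spec rel₁ loading
      in subst (λ j → Loaded (suc j) (suc (suc j)) s′) j≡
           (extendTables-spec rel₂ (subst (λ j → Loaded (suc j) (suc j) s₁) (sym j≡) half))

  module _ (S : Subset n) where

    Bit : ℕ → ℕ → Set
    Bit j x = ∀ i → toℕ i ≡ j → (0 ℕ.<ᵇ x) ≡ lookup S i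

    -- The claim on `REST` is confined to `k ≤ n`: the round `j = n` decodes no job, and nothing is
    -- asserted about the remainder it leaves.
    Decoding : ℕ → State → Set c
    Decoding k s = Initialised s × (k ℕ.≤ n → nats s REST 0 ≡ suffix S k) × (∀ j → j ℕ.< k → Bit j (nats s RESULT j))

    -- By `suffix-<` the later members together stay below the place of `i`, so the comparison
    -- reveals whether `i` belongs to `S`.
    bit-true : ∀ i {j} → toℕ i ≡ j → place (n ℕ.∸ j) ℕ.≤ suffix S j →
               lookup S i ≡ true × suffix S j ℕ.∸ place (n ℕ.∸ j) ≡ suffix S (suc j)
    bit-true i refl p≤ with lookup S i | suffix-step S i
    ... | true  | eq = refl , trans (cong (ℕ._∸ place (n ℕ.∸ toℕ i)) eq) (ℕ.m+n∸m≡n (place (n ℕ.∸ toℕ i)) _)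
    ... | false | eq = contradiction (subst (place (n ℕ.∸ toℕ i) ℕ.≤_) eq p≤) (ℕ.<⇒≱ (suffix-< S i))

    bit-false : ∀ i {j} → toℕ i ≡ j → ¬ place (n ℕ.∸ j) ℕ.≤ suffix S j →
                lookup S i ≡ false × suffix S j ≡ suffix S (suc j)
    bit-false i refl p≰ with lookup S i | suffix-step S i
    ... | true  | eq = contradiction (subst (place (n ℕ.∸ toℕ i) ℕ.≤_) (sym eq) (ℕ.m≤m+n _ _)) p≰
    ... | false | eq = refl , eq

    decodeBit-spec : ∀ {s s′} → decodeBit ⊢ s ↦ s′ → nats s J 0 ℕ.≤ n → Decoding (nats s J 0) s →
      Decoding (suc (nats s J 0)) s′
    decodeBit-spec {s} rel j≤n (T , rest , bits) = decoded (if-inv rel)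
      where
      j = nats s J 0

      code≡ : nats s CODE (nats s COUNT 0 ℕ.∸ j) ≡ place (n ℕ.∸ j)
      code≡ = trans (cong (λ n → nats s CODE (n ℕ.∸ j)) (Tables.countOk T)) (Tables.codeOk T _ (ℕ.m∸n≤m n j))

      fitsRest = test (get CODE (var COUNT ⊟ var J) ≤ᴺ var REST)

      decoded : ∀ {s′} →
        (holds fitsRest s × (setᴺ RESULT (var J) (lit 1) ⨾ setᴺ REST (lit 0) (var REST ⊟ get CODE (var COUNT ⊟ var J)) ⊢ s ↦ s′))
        ⊎ (¬ holds fitsRest s × (setᴺ RESULT (var J) (lit 0) ⊢ s ↦ s′)) → Decoding (suc j) s′
      decoded (inj₁ (lift h , run)) = T
        , (λ j<n → trans (cong₂ ℕ._∸_ (rest j≤n) code≡) (proj₂ (bit-true (fromℕ< j<n) (Fin.toℕ-fromℕ< j<n) h′)))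
        , write-extend Bit (nats s) RESULT j 1 bits (λ i i≡j → sym (proj₁ (bit-true i i≡j h′)))
        where h′ = subst₂ ℕ._≤_ code≡ (rest j≤n) h
      decoded (inj₂ (¬h , run)) = T
        , (λ j<n → trans (rest j≤n) (proj₂ (bit-false (fromℕ< j<n) (Fin.toℕ-fromℕ< j<n) ¬h′)))
        , write-extend Bit (nats s) RESULT j 0 bits (λ i i≡j → sym (proj₁ (bit-false i i≡j ¬h′)))
        where
        ¬h′ : ¬ place (n ℕ.∸ j) ℕ.≤ suffix S j
        ¬h′ p≤ = ¬h (lift (subst₂ ℕ._≤_ (sym code≡) (sym (rest j≤n)) p≤))

    output-spec : ∀ {s s′} → output ⊢ s ↦ s′ → Initialised s → nats s BEST 0 ≡ suc (encoding S) →
      result I s′ ≡ S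
    output-spec {s} rel T best≡ = finish (⨾-inv rel)
      where
      finish : ∀ {s″} →
        ∃[ s′ ] (setᴺ REST (lit 0) (get BEST (lit 0) ⊟ lit 1) ⊢ s ↦ s′) × (loop J decodeBit ⊢ s′ ↦ s″) →
               result I s″ ≡ S
      finish {s″} (_ , run , rel) =
        let _ , _ , bits = loop-invariant J decodeBit Decoding n (λ x pr → pr)
              (λ { _ j≤n refl rel dec → decodeBit-spec rel j≤n dec })
              rel (Tables.countOk T) (T , (λ _ → cong (ℕ._∸ 1) best≡) , λ _ ())
        in trans (tabulate-cong (λ i → bits (toℕ i) (ℕ.m<n⇒m<1+n (Fin.toℕ<n i)) i refl)) (tabulate∘lookup S)

  -- Turns a time bound in the number of jobs into one in the input size; each job contributes at
  -- least 1.
  n≤inputSize : n ℕ.≤ inputSize I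
  n≤inputSize = n≤sum (λ i → bitLength (start (job I i)) ℕ.+ bitLength (end (job I i)) ℕ.+ 1) λ i → s≤s z≤n
    where
    open RawMonoidOps ℕ.+-0-rawMonoid renaming (sum to sumℕ)
    n≤sum : ∀ {m} (f : Fin m → ℕ) → (∀ i → 1 ℕ.≤ f i) → m ℕ.≤ sumℕ f
    n≤sum {zero}  f 1≤f = z≤n
    n≤sum {suc m} f 1≤f = ℕ.+-mono-≤ (1≤f zero) (n≤sum (f ∘ suc) (1≤f ∘ suc))

-- Optimality of the output

module Main {c ℓ₁ ℓ₂} (R : OrderedAbelianGroup c ℓ₁ ℓ₂) (I : RIS.Jobs R) where

  open OrderedAbelianGroup R
  open OrderedGroupProperties R
  open Semantics R
  open Execution R
  open RIS R
  open Scheduling R I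
  open Memory R I
  open Searching R I
  open Guessing R I
  open InputOutput R I

  algorithm-spec : ∀ {s} → algorithm ⊢ load I ↦ s → Optimal I (result I s)
  algorithm-spec {s} rel =
    let s₁ , rel₁ , rel = ⨾-inv rel
        s₂ , rel₂ , rel₃ = ⨾-inv rel
        T , best≡0 = initialise-spec rel₁
        (T′ , best) , _ , found = search-spec rel₂ (T , λ 1≤ → contradiction (subst (1 ℕ.≤_) best≡0 1≤) λ ())
        dominated : ∀ S → Feasible I S → BestDominates s₂ (robustValue I S)
        dominated S feas = let x , y , e₁ , e₂ , cert = certified R I S feas in found x y e₁ e₂ cert
        -- The empty set is feasible, so an entry is certainly present.
        S , feas , best≡ , ≤V = best (proj₁ (dominated ⊥ λ _ _ i∈⊥ → contradiction i∈⊥ ∉⊥))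
    in subst (Optimal I) (sym (output-spec S rel₃ T′ best≡))
         (feas , λ S′ feas′ → ≤-trans (proj₂ (dominated S′ feas′)) ≤V)

theorem6 : ∀ {c ℓ₁ ℓ₂} (R : OrderedAbelianGroup c ℓ₁ ℓ₂) →
  PolynomialTimeAlgorithm R (RobustIntervalScheduling R)
theorem6 R = compile algorithm , time algorithm , λ I →
  -- The two syntactic conditions on the code hold by evaluation.
  let t , halts , t≤ = compile-⇓ algorithm refl refl (RIS.load R I)
  in exec algorithm (RIS.load R I) , t , halts
     , ℕ.≤-trans t≤ (evalPoly-mono (time algorithm) (InputOutput.n≤inputSize R I))
     , Main.algorithm-spec R I run
  where open Execution R
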